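{- For every $\ell\ge4$, \[T_\ell\le 10^{2^{\ell-4}}\beta_\ell\prod_{i=4}^{\ell-1}\beta_i^{2^{\ell-1-i}}\qquad\text{and}\qquad Z_\ell\le 10^{2^{\ell-4}}\gamma_\ell\prod_{i=4}^{\ell-1}\beta_i^{2^{\ell-1-i}},\] where \[\beta_\ell=A_\ell\binom{2^{\ell}-3}{\ell}\binom{2^{\ell}-3-\ell}{2^{\ell-1}-2,\,2^{\ell-2}-2,\,2^{\ell-3}-1,\,2^{\ell-4}-1,\dots,2^1-1},\] \[\gamma_\ell=A_\ell\binom{2^{\ell}-5}{\ell}\binom{2^{\ell}-5-\ell}{2^{\ell-1}-3,\,2^{\ell-2}-3,\,2^{\ell-3}-1,\,2^{\ell-4}-1,\dots,2^1-1}.\]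
   Context: The tree is the infinite rooted binary tree (every vertex has a left and a right child) with a self-loop at the root; the root is on layer $1$ and children of a layer-$k$ vertex are on layer $k+1$. Labeled chip-firing: initially $N$ chips labeled $1,\dots,N$ sit at the root; a vertex with at least $3$ chips may fire by choosing any $3$ of its chips $a<b<c$ and sending $a$ to its left child, $c$ to its right child, and $b$ to its parent (the root keeps $b$). A stable configuration is one reached by finitely many fires in which no vertex holds $\ge 3$ chips; starting from $2^m-1$ chips, a stable configuration has exactly one chip on each vertex of layers $1,\dots,m$ and none elsewhere. $Z_\ell$ is the number of distinct stable configurations obtainable from $2^{\ell}-1$ labeled chips at the root. For $\ell\ge1$, an order pattern of size $\ell$ is obtained as follows: take $m>\ell$, a stable configuration from $2^m-1$ labeled chips at the root, and a non-root vertex $v$ on layer $m-\ell+1$; on the $2^{\ell}-1$ vertices of the subtree of $v$ lying in layers $m-\ell+1,\dots,m$, replace each chip by its rank among these chips. $T_\ell$ is the number of distinct order patterns of size $\ell$ that arise. $A_n$ is the Euler zigzag number (OEIS A000111): the number of permutations $\sigma$ of $\{1,\dots,n\}$ with $\sigma_1<\sigma_2>\sigma_3<\cdots$. $\binom{M}{k_1,\dots,k_r}=M!/(k_1!\cdots k_r!)$ with $\sum k_j=M$. Empty products equal $1$. -}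

module Defs where

open import Data.Nat using (ℕ; zero; suc; _+_; _*_; _∸_; _^_; _≤_; _<_; _<ᵇ_; _!; NonZero)
open import Data.Nat.Properties using (_!≢0; m*n≢0)
open import Data.Nat.Combinatorics using (_C_)
open import Data.Nat.ListAction using (product)
open import Data.Nat.DivMod using (_/_)
open import Data.Bool using (Bool; true; false; _∧_; if_then_else_)
open import Data.Bool.Properties using () renaming (_≟_ to _≟B_)
open import Data.List using (List; []; _∷_; length; drop; take; map; applyUpTo; upTo; mapMaybe; filter; concatMap; _++_)
open import Data.List.Properties using (≡-dec)
open import Data.Maybe using (Maybe; just; nothing)
open import Data.Vec using (Vec; lookup; _[_]≔_; replicate; toList)
open import Data.Fin using (Fin; toℕ)
open import Data.Product using (Σ; ∃; _×_; _,_)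
open import Relation.Binary.PropositionalEquality using (_≡_)
open import Relation.Binary.Construct.Closure.ReflexiveTransitive using (Star)
open import Relation.Nullary using (yes; no)
open import Relation.Nullary.Decidable using (⌊_⌋)
open import Relation.Binary.Definitions using (DecidableEquality)
open import Data.List.Relation.Unary.Unique.Propositional using (Unique)
open import Data.List.Relation.Unary.All using (All)

prodFact : List ℕ → ℕ
prodFact []       = 1
prodFact (k ∷ ks) = k ! * prodFact ks

prodFact≢0 : ∀ ks → NonZero (prodFact ks)
prodFact≢0 []       = _
prodFact≢0 (k ∷ ks) = m*n≢0 (k !) (prodFact ks) {{k !≢0}} {{prodFact≢0 ks}}

-- multinomial M (k₁,…,k_r) = M! / (k₁! ⋯ k_r!)   (used with Σ kⱼ = M)
multinomial : ℕ → List ℕ → ℕ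
multinomial M ks = _/_ (M !) (prodFact ks) {{prodFact≢0 ks}}

insertions : ℕ → List ℕ → List (List ℕ)
insertions x []       = (x ∷ []) ∷ []
insertions x (y ∷ ys) = (x ∷ y ∷ ys) ∷ map (y ∷_) (insertions x ys)

perms : List ℕ → List (List ℕ)
perms []       = [] ∷ []
perms (x ∷ xs) = concatMap (insertions x) (perms xs)

alternatingFrom : Bool → List ℕ → Bool
alternatingFrom up []           = true
alternatingFrom up (x ∷ [])     = true
alternatingFrom true  (x ∷ y ∷ ys) = (x <ᵇ y) ∧ alternatingFrom false (y ∷ ys)
alternatingFrom false (x ∷ y ∷ ys) = (y <ᵇ x) ∧ alternatingFrom true (y ∷ ys)

zigzag : ℕ → ℕ
zigzag n = length (filter (λ σ → alternatingFrom true σ ≟B true) (perms (applyUpTo suc n)))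

-- ∏_{i=a}^{b} f i  (empty product = 1 when b < a)
prodFromTo : ℕ → ℕ → (ℕ → ℕ) → ℕ
prodFromTo a b f = product (map (λ j → f (a + j)) (upTo (suc b ∸ a)))

betaParts : ℕ → List ℕ
betaParts ℓ = (2 ^ (ℓ ∸ 1) ∸ 2) ∷ (2 ^ (ℓ ∸ 2) ∸ 2) ∷ map (λ j → 2 ^ (1 + j) ∸ 1) (upTo (ℓ ∸ 3))

gammaParts : ℕ → List ℕ
gammaParts ℓ = (2 ^ (ℓ ∸ 1) ∸ 3) ∷ (2 ^ (ℓ ∸ 2) ∸ 3) ∷ map (λ j → 2 ^ (1 + j) ∸ 1) (upTo (ℓ ∸ 3))

β : ℕ → ℕ
β ℓ = zigzag ℓ * ((2 ^ ℓ ∸ 3) C ℓ) * multinomial (2 ^ ℓ ∸ 3 ∸ ℓ) (betaParts ℓ)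

γ : ℕ → ℕ
γ ℓ = zigzag ℓ * ((2 ^ ℓ ∸ 5) C ℓ) * multinomial (2 ^ ℓ ∸ 5 ∸ ℓ) (gammaParts ℓ)

commonFactor : ℕ → ℕ
commonFactor ℓ = 10 ^ (2 ^ (ℓ ∸ 4)) * prodFromTo 4 (ℓ ∸ 1) (λ i → β i ^ (2 ^ (ℓ ∸ 1 ∸ i)))

TBound : ℕ → ℕ
TBound ℓ = commonFactor ℓ * β ℓ

ZBound : ℕ → ℕ
ZBound ℓ = commonFactor ℓ * γ ℓ

-- A vertex is the path from the root, stored with the LAST step first:
-- [] is the root (layer 1); false ∷ v / true ∷ v are the left / right
-- children of v; a vertex v lies on layer (length v + 1).
Vertex : Set
Vertex = List Bool

_≟V_ : DecidableEquality Vertex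
_≟V_ = ≡-dec _≟B_

leftChild rightChild parent : Vertex → Vertex
leftChild v  = false ∷ v
rightChild v = true ∷ v
parent []      = []          -- self-loop at the root: the root keeps b
parent (_ ∷ v) = v

-- A configuration of N labeled chips: chip i (label toℕ i + 1) sits at
-- vertex (lookup c i).
Config : ℕ → Set
Config N = Vec Vertex N

initial : (N : ℕ) → Config N
initial N = replicate N []

Fire : ∀ {N} → Config N → Config N → Set
Fire {N} cfg cfg′ =
  Σ Vertex λ v → Σ (Fin N) λ a → Σ (Fin N) λ b → Σ (Fin N) λ c →
    (toℕ a < toℕ b) × (toℕ b < toℕ c) ×
    (lookup cfg a ≡ v) × (lookup cfg b ≡ v) × (lookup cfg c ≡ v) ×
    (cfg′ ≡ ((cfg [ a ]≔ leftChild v) [ b ]≔ parent v) [ c ]≔ rightChild v)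

Reachable : ∀ {N} → Config N → Set
Reachable {N} cfg = Star Fire (initial N) cfg

chipsAt : ∀ {N} → Config N → Vertex → ℕ
chipsAt cfg v = length (filter (λ w → w ≟V v) (toList cfg))

IsStable : ∀ {N} → Config N → Set
IsStable cfg = ∀ v → chipsAt cfg v < 3

StableConfig : ∀ {N} → Config N → Set
StableConfig cfg = Reachable cfg × IsStable cfg

relative : Vertex → Vertex → Maybe Vertex
relative v u with drop (length u ∸ length v) u ≟V v
... | yes _ = just (take (length u ∸ length v) u)
... | no  _ = nothing

inWindow : ℕ → Vertex → Vertex → Maybe Vertex
inWindow ℓ v u with relative v u
... | nothing = nothing
... | just w  = if length w <ᵇ ℓ then just w else nothing

-- The order pattern: chips lying in the window, listed in increasing
-- label order (so the k-th entry is the position, relative to v, of the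
-- chip of rank k), i.e. the configuration with chips replaced by ranks.
pattern′ : ∀ {N} → ℕ → Vertex → Config N → List Vertex
pattern′ ℓ v cfg = mapMaybe (inWindow ℓ v) (toList cfg)

IsOrderPattern : ℕ → List Vertex → Set
IsOrderPattern ℓ p =
  Σ ℕ λ m → (ℓ < m) ×
  Σ (Config (2 ^ m ∸ 1)) λ cfg → StableConfig cfg ×
  Σ Vertex λ v → (length v ≡ m ∸ ℓ) ×      -- v on layer m-ℓ+1 (non-root as m > ℓ)
  (p ≡ pattern′ ℓ v cfg)

AtMost : {A : Set} → (A → Set) → ℕ → Set
AtMost {A} P B = (xs : List A) → Unique xs → All P xs → length xs ≤ B

T≤ : ℕ → ℕ → Set
T≤ ℓ B = AtMost (IsOrderPattern ℓ) B

Z≤ : ℕ → ℕ → Set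
Z≤ ℓ B = AtMost (StableConfig {2 ^ ℓ ∸ 1}) B

{-# OPTIONS --safe #-}

-- The window below a vertex consists of its top chip and of the windows below its two children.  Hence a pattern of size ℓ
-- is determined by two patterns of size ℓ - 1 and a word telling which of the three parts holds the chip of each rank.
-- The smallest chip lies in the left part and the largest in the right one, so that
--   T_ℓ ≤ (2^ℓ - 3)! / (2^(ℓ-1) - 2)!² · T_{ℓ-1}²,
-- and likewise Z_ℓ ≤ (2^ℓ - 5)! / (2^(ℓ-1) - 3)!² · T_{ℓ-1}², because the two smallest chips end on the left of the root and
-- the two largest on its right.  The bounds of the theorem satisfy these recursions because n A_{n-1} ≤ 2 A_n: prepend any
-- value to a reversed zigzag sequence and, if the first step goes the wrong way, exchange the first two entries.
-- For ℓ = 4 the recursion starts from at most 20 patterns of size 3 below a left (or right) vertex, and at most 14 below a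
-- child of the root of a tree with four layers.
--
-- The positions of the extreme chips come from the last fires.  Counting the fires still to come, the last h fires of a
-- vertex of height h alternate with those of its parent and of its children, and each of them uses exactly the three chips
-- present.  If the left subtree of a vertex holds no chip below a given threshold, then all fires of that vertex were free
-- of such chips, and the alternation shows that none can arrive later.
module Submission where

open import Defs
open import Data.Nat
open import Data.Nat.Properties
open import Data.Nat.Combinatorics using (_C_; nCk≡n!/k![n-k]!; k![n∸k]!∣n!)
open import Data.Nat.DivMod using (m/n*n≡m)
open import Data.Nat.Divisibility using (_∣_; ∣-refl; ∣-trans; *-monoʳ-∣)
open import Data.Nat.ListAction using (sum; product)
open import Data.Nat.ListAction.Properties using (sum-++)
open import Data.Nat.Tactic.RingSolver using (solve-∀)
open import Data.Bool using (Bool; true; false; not; _∧_; if_then_else_)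
open import Data.Bool.Properties using (∧-conicalˡ; ∧-conicalʳ; T-≡; ¬-not) renaming (_≟_ to _≟B_)
open import Data.Empty using (⊥; ⊥-elim)
open import Data.Fin using (Fin; toℕ; zero; suc)
open import Data.Fin.Properties using (toℕ<n; toℕ-injective) renaming (_≟_ to _≟F_)
open import Data.List using (List; []; _∷_; _++_; _∷ʳ_; [_]; length; map; filter; mapMaybe; take; drop; last; initLast; _∷ʳ′_; deduplicate; cartesianProduct; applyUpTo; upTo)
open import Data.List.Membership.DecPropositional _≟_ using (_∈?_)
open import Data.List.Membership.Propositional using (_∈_; _∉_; find; lose)
open import Data.List.Membership.Propositional.Properties
open import Data.List.Properties using (length-++; length-map; length-applyUpTo; ∷-injective; ∷-injectiveʳ; ∷ʳ-injective; ≡-dec; map-++; map-upTo; applyUpTo-∷ʳ; mapMaybe-++; ++-assoc; ++-identityʳ; ++-cancelʳ; take++drop≡id; filter-all; filter-accept; filter-reject)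
open import Data.List.Relation.Unary.All as All using (All; []; _∷_)
import Data.List.Relation.Unary.All.Properties as All
open import Data.List.Relation.Unary.AllPairs using (AllPairs; []; _∷_)
import Data.List.Relation.Unary.AllPairs.Properties as AllPairs
open import Data.List.Relation.Unary.Any using (here; there)
import Data.List.Relation.Unary.Unique.DecPropositional.Properties as DecUnique
open import Data.List.Relation.Unary.Unique.Propositional using (Unique)
import Data.List.Relation.Unary.Unique.Propositional.Properties as Unique
open import Data.Maybe using (Maybe; just; nothing; _>>=_)
import Data.Maybe as Maybe
import Data.Maybe.Properties as Maybe
open import Data.Product using (∃; ∃₂; Σ; _×_; _,_; proj₁; proj₂)
import Data.Product.Properties as Product
open import Data.Sum using (_⊎_; inj₁; inj₂)
open import Data.Vec using (Vec; lookup; _[_]≔_; toList; []; _∷_)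
open import Data.Vec.Properties using (lookup∘update; lookup∘update′; lookup-replicate; toList-injective; cast-is-id)
open import Function using (_∘_; id; case_of_)
open import Function.Bundles using (Equivalence)
open import Relation.Binary.Construct.Closure.ReflexiveTransitive using (Star; ε; _◅_)
open import Relation.Binary.Definitions using (DecidableEquality; tri<; tri≈; tri>)
open import Relation.Binary.PropositionalEquality hiding ([_])
open import Relation.Nullary using (¬_; Dec; yes; no; does; contradiction)
open import Relation.Nullary.Decidable using (¬?; _×-dec_)
open import Relation.Unary using (Decidable)

-- Cardinalities

-- The number of fires of a vertex is not taken as known. Conservation of chips suggests it: across
-- the edge above a vertex of height h the net flow is `fires (suc h)` minus `fires h`, and it has
-- to fill a subtree with `full (suc h)` vertices. A function `r` starts at these values and is
-- lowered by every fire; the balance at a vertex that can fire shows `r` positive there, and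
-- stability forces `r` to vanish everywhere. So one chip per vertex is a consequence, and most
-- invariants about positions carry a hypothesis that `r` is below the height, which fails at the
-- start and holds at the end. The recursion for T has a factor of more than 2 to spare in each
-- step, the one for Z only what the zigzag inequality leaves. The obstacle is ℓ = 4: the 30 words
-- that fit the extreme chips of a window of size 3 would give 12012 * 30 * 30 = 10810800 for T,
-- above the bound 9009000, and even 20 patterns per side would give 2772 * 20 * 20 = 1108800 for Z,
-- above 693000. Hence the closer look at windows of size 3.

unique⊆⇒length≤ : {A : Set} {xs ys : List A} → Unique xs → (∀ {x} → x ∈ xs → x ∈ ys) → length xs ≤ length ys
unique⊆⇒length≤ {xs = []} _ _ = z≤n
unique⊆⇒length≤ {xs = x ∷ xs} (x∉xs ∷ uxs) sub with ∈-∃++ (sub (here refl))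
... | as , bs , refl = begin
  suc (length xs)            ≤⟨ s≤s (unique⊆⇒length≤ uxs sub′) ⟩
  suc (length (as ++ bs))    ≡⟨ cong suc (length-++ as) ⟩
  suc (length as + length bs) ≡⟨ +-suc (length as) (length bs) ⟨
  length as + suc (length bs) ≡⟨ length-++ as ⟨
  length (as ++ x ∷ bs)      ∎
  where
  open ≤-Reasoning
  sub′ : ∀ {y} → y ∈ xs → y ∈ as ++ bs
  sub′ y∈xs with ∈-++⁻ as (sub (there y∈xs))
  ... | inj₁ y∈as         = ∈-++⁺ˡ y∈as
  ... | inj₂ (here refl)  = contradiction refl (All.lookup x∉xs y∈xs)
  ... | inj₂ (there y∈bs) = ∈-++⁺ʳ as y∈bs

AtMost-≤ : {A : Set} {P : A → Set} {m n : ℕ} → m ≤ n → AtMost P m → AtMost P n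
AtMost-≤ m≤n P≤m xs uxs pxs = ≤-trans (P≤m xs uxs pxs) m≤n

AtMost-∈ : {A : Set} (ys : List A) → AtMost (_∈ ys) (length ys)
AtMost-∈ ys xs uxs xs∈ys = unique⊆⇒length≤ uxs (All.lookup xs∈ys)

AtMost-filter : {A : Set} {P : A → Set} (P? : Decidable P) (ys : List A) → AtMost (λ x → x ∈ ys × P x) (length (filter P? ys))
AtMost-filter P? ys xs uxs pxs = unique⊆⇒length≤ uxs λ x∈ → let x∈ys , px = All.lookup pxs x∈ in ∈-filter⁺ P? x∈ys px

AtMost-injective : {A B : Set} {P : A → Set} {Q : B → Set} {n : ℕ} (f : A → B) →
                   (∀ {x} → P x → Q (f x)) → (∀ {x y} → P x → P y → f x ≡ f y → x ≡ y) →
                   AtMost Q n → AtMost P n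
AtMost-injective {P = P} {Q} f P⇒Q inj Q≤n xs uxs pxs =
  subst (_≤ _) (length-map f xs) (Q≤n (map f xs) (unique-map uxs pxs) (All.map⁺ (All.map P⇒Q pxs)))
  where
  fresh : ∀ {x ys} → P x → All (x ≢_) ys → All P ys → All (f x ≢_) (map f ys)
  fresh px [] [] = []
  fresh px (x≢y ∷ x≢ys) (py ∷ pys) = x≢y ∘ inj px py ∷ fresh px x≢ys pys
  unique-map : ∀ {ys} → Unique ys → All P ys → Unique (map f ys)
  unique-map [] [] = []
  unique-map (y∉ys ∷ uys) (py ∷ pys) = fresh py y∉ys pys ∷ unique-map uys pys

length-cartesianProduct : {A B : Set} (xs : List A) (ys : List B) →
                          length (cartesianProduct xs ys) ≡ length xs * length ys
length-cartesianProduct [] ys = refl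
length-cartesianProduct (x ∷ xs) ys = trans (length-++ (map (x ,_) ys))
  (cong₂ _+_ (length-map (x ,_) ys) (length-cartesianProduct xs ys))

-- `P` and `Q` come without enumerations. The deduplicated projections of the given list take their
-- place: they satisfy `P` and `Q`, and their product contains the list.
AtMost-× : {A B : Set} {P : A → Set} {Q : B → Set} {m n : ℕ} →
           DecidableEquality A → DecidableEquality B → AtMost P m → AtMost Q n →
           AtMost (λ (x , y) → P x × Q y) (m * n)
AtMost-× {P = P} {Q} {m} {n} _≟A_ _≟B_ P≤m Q≤n zs uzs pzs = begin
  length zs                        ≤⟨ unique⊆⇒length≤ uzs sub ⟩
  length (cartesianProduct xs ys)  ≡⟨ length-cartesianProduct xs ys ⟩
  length xs * length ys            ≤⟨ *-mono-≤
      (P≤m xs (DecUnique.deduplicate-! _≟A_ _) (All.deduplicate⁺ _≟A_ (All.map⁺ (All.map proj₁ pzs))))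
      (Q≤n ys (DecUnique.deduplicate-! _≟B_ _) (All.deduplicate⁺ _≟B_ (All.map⁺ (All.map proj₂ pzs)))) ⟩
  m * n                            ∎
  where
  open ≤-Reasoning
  xs = deduplicate _≟A_ (map proj₁ zs)
  ys = deduplicate _≟B_ (map proj₂ zs)
  sub : ∀ {z} → z ∈ zs → z ∈ cartesianProduct xs ys
  sub z∈zs = ∈-cartesianProduct⁺ (∈-deduplicate⁺ _≟A_ (∈-map⁺ proj₁ z∈zs)) (∈-deduplicate⁺ _≟B_ (∈-map⁺ proj₂ z∈zs))

-- Zigzag numbers

-- For a list without repetitions these conditions amount to membership in `perms xs`, but they can
-- be checked without following the insertions that build a permutation.
record Rearrangement (xs σ : List ℕ) : Set where
  constructor rearrangement
  field
    unique   : Unique σ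
    support  : ∀ {y} → y ∈ σ → y ∈ xs
    size     : length σ ≡ length xs

∈-insertions : ∀ x as bs → as ++ x ∷ bs ∈ insertions x (as ++ bs)
∈-insertions x [] [] = here refl
∈-insertions x [] (b ∷ bs) = here refl
∈-insertions x (a ∷ as) bs = there (∈-map⁺ (a ∷_) (∈-insertions x as bs))

insertions⇒++ : ∀ x ys {σ} → σ ∈ insertions x ys → ∃₂ λ as bs → ys ≡ as ++ bs × σ ≡ as ++ x ∷ bs
insertions⇒++ x [] (here refl) = [] , [] , refl , refl
insertions⇒++ x (y ∷ ys) (here refl) = [] , y ∷ ys , refl , refl
insertions⇒++ x (y ∷ ys) (there σ∈) with ∈-map⁻ (y ∷_) σ∈
... | σ′ , σ′∈ , refl with insertions⇒++ x ys σ′∈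
... | as , bs , refl , refl = y ∷ as , bs , refl , refl

unique-insert : ∀ {x : ℕ} as {bs} → x ∉ as ++ bs → Unique (as ++ bs) → Unique (as ++ x ∷ bs)
unique-insert [] x∉ u = All.tabulate (λ y∈ x≡y → x∉ (subst (_∈ _) (sym x≡y) y∈)) ∷ u
unique-insert {x} (a ∷ as) {bs} x∉ (a∉ ∷ u) =
  All.++⁺ (All.++⁻ˡ as a∉) ((λ a≡x → x∉ (here (sym a≡x))) ∷ All.++⁻ʳ as a∉)
  ∷ unique-insert as (x∉ ∘ there) u

unique-delete : ∀ {x : ℕ} as {bs} → Unique (as ++ x ∷ bs) → x ∉ as ++ bs × Unique (as ++ bs)
unique-delete [] (x∉ ∷ u) = (λ x∈ → All.lookup x∉ x∈ refl) , u
unique-delete {x} (a ∷ as) {bs} (a∉ ∷ u) with unique-delete as u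
... | x∉ , u′ = (λ { (here refl) → All.head (All.++⁻ʳ as a∉) refl ; (there x∈) → x∉ x∈ })
  , All.++⁺ (All.++⁻ˡ as a∉) (All.tail (All.++⁻ʳ as a∉)) ∷ u′

length-insert : ∀ {x : ℕ} as {bs} → length (as ++ x ∷ bs) ≡ suc (length (as ++ bs))
length-insert [] = refl
length-insert (a ∷ as) = cong suc (length-insert as)

perms⇒rearrangement : ∀ {xs σ} → Unique xs → σ ∈ perms xs → Rearrangement xs σ
perms⇒rearrangement {[]} _ (here refl) = rearrangement [] id refl
perms⇒rearrangement {x ∷ xs} (x∉xs ∷ uxs) σ∈ with ∈-concatMap⁻ (insertions x) {xs = perms xs} σ∈
... | σ∈′ with find σ∈′
... | ys , ys∈ , σ∈ins with insertions⇒++ x ys σ∈ins | perms⇒rearrangement uxs ys∈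
... | as , bs , refl , refl | rearrangement u s z =
  rearrangement (unique-insert as (λ x∈ → All.lookup x∉xs (s x∈) refl) u) support′ (trans (length-insert as) (cong suc z))
  where
  support′ : ∀ {y} → y ∈ as ++ x ∷ bs → y ∈ x ∷ xs
  support′ y∈ with ∈-++⁻ as y∈
  ... | inj₁ y∈as = there (s (∈-++⁺ˡ y∈as))
  ... | inj₂ (here refl) = here refl
  ... | inj₂ (there y∈bs) = there (s (∈-++⁺ʳ as y∈bs))

-- By pigeonhole `x` occurs in `σ`; removing it leaves a rearrangement of the tail.
rearrangement⇒perms : ∀ {xs σ} → Rearrangement xs σ → σ ∈ perms xs
rearrangement⇒perms {[]} {[]} _ = here refl
rearrangement⇒perms {x ∷ xs} {σ} (rearrangement u s z) with x ∈? σ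
... | no x∉σ = contradiction
  (subst (_≤ length xs) z (unique⊆⇒length≤ u λ y∈ → case s y∈ of λ { (here refl) → contradiction y∈ x∉σ ; (there p) → p }))
  (<⇒≱ ≤-refl)
... | yes x∈σ with ∈-∃++ x∈σ
... | as , bs , refl with unique-delete as u
... | x∉ , u′ = ∈-concatMap⁺ (insertions x) (lose {P = λ ys → as ++ x ∷ bs ∈ insertions x ys} (rearrangement⇒perms (rearrangement u′ s′ (suc-injective (trans (sym (length-insert as)) z)))) (∈-insertions x as bs))
  where
  s′ : ∀ {y} → y ∈ as ++ bs → y ∈ xs
  s′ {y} y∈ with s (case ∈-++⁻ as y∈ of λ { (inj₁ p) → ∈-++⁺ˡ p ; (inj₂ p) → ∈-++⁺ʳ as (there p) })
  ... | here refl = contradiction y∈ x∉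
  ... | there p = p

delete : ℕ → List ℕ → List ℕ
delete x = filter (¬? ∘ (x ≟_))

delete-insertion : ∀ {x ys σ} → x ∉ ys → σ ∈ insertions x ys → delete x σ ≡ ys
delete-insertion {x} {ys} x∉ys σ∈ with insertions⇒++ x ys σ∈
... | as , bs , refl , refl = go as x∉ys
  where
  fresh : ∀ {cs} → x ∉ cs → All (λ y → ¬ x ≡ y) cs
  fresh x∉cs = All.tabulate (λ y∈ x≡y → x∉cs (subst (_∈ _) (sym x≡y) y∈))
  go : ∀ as → x ∉ as ++ bs → delete x (as ++ x ∷ bs) ≡ as ++ bs
  go [] x∉ = trans (filter-reject (¬? ∘ (x ≟_)) (λ x≢x → x≢x refl)) (filter-all (¬? ∘ (x ≟_)) (fresh x∉))
  go (a ∷ as) x∉ = trans (filter-accept (¬? ∘ (x ≟_)) (λ x≡a → x∉ (here x≡a))) (cong (a ∷_) (go as (x∉ ∘ there)))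

unique-insertions : ∀ {x ys} → x ∉ ys → Unique (insertions x ys)
unique-insertions {x} {[]} _ = [] ∷ []
unique-insertions {x} {y ∷ ys} x∉ =
  All.tabulate (λ σ∈ x≡ → case ∈-map⁻ (y ∷_) σ∈ of λ { (_ , _ , refl) → x∉ (here (proj₁ (∷-injective x≡))) })
  ∷ Unique.map⁺ (proj₂ ∘ ∷-injective) (unique-insertions (x∉ ∘ there))

-- Deleting `x` recovers the permutation into which it was inserted, so different permutations of
-- the tail have disjoint lists of insertions.
unique-perms : ∀ {xs} → Unique xs → Unique (perms xs)
unique-perms {[]} _ = [] ∷ []
unique-perms {x ∷ xs} (x∉xs ∷ uxs) = Unique.concat⁺
  (All.map⁺ (All.tabulate (unique-insertions ∘ x∉)))
  (AllPairs.map⁺ (separated (unique-perms uxs) x∉))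
  where
  x∉ : ∀ {ys} → ys ∈ perms xs → x ∉ ys
  x∉ ys∈ x∈ys = All.lookup x∉xs (Rearrangement.support (perms⇒rearrangement uxs ys∈) x∈ys) refl
  separated : ∀ {yss} → Unique yss → (∀ {ys} → ys ∈ yss → x ∉ ys) →
              AllPairs (λ ys zs → ∀ {σ} → σ ∈ insertions x ys × σ ∈ insertions x zs → ⊥) yss
  separated [] _ = []
  separated (ys∉ ∷ u) fresh =
    All.tabulate (λ {zs} zs∈ (p , q) → All.lookup ys∉ zs∈
      (trans (sym (delete-insertion (fresh (here refl)) p)) (delete-insertion (fresh (there zs∈)) q)))
    ∷ separated u (fresh ∘ there)

range : ℕ → List ℕ
range = applyUpTo suc

∈-range⁺ : ∀ {n y} → 1 ≤ y → y ≤ n → y ∈ range n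
∈-range⁺ (s≤s _) y≤n = ∈-applyUpTo⁺ suc y≤n

∈-range⁻ : ∀ {n y} → y ∈ range n → 1 ≤ y × y ≤ n
∈-range⁻ y∈ with ∈-applyUpTo⁻ suc y∈
... | i , i<n , refl = s≤s z≤n , i<n

unique-range : ∀ n → Unique (range n)
unique-range n = Unique.applyUpTo⁺₁ suc n (λ i<j _ eq → <⇒≢ i<j (suc-injective eq))

zigzags : ℕ → List (List ℕ)
zigzags n = filter (λ σ → alternatingFrom true σ ≟B true) (perms (range n))

<ᵇ⁺ : ∀ {x y} → x < y → (x <ᵇ y) ≡ true
<ᵇ⁺ x<y = Equivalence.to T-≡ (<⇒<ᵇ x<y)

<ᵇ⁻ : ∀ {x y} → (x <ᵇ y) ≡ true → x < y
<ᵇ⁻ {x} {y} eq = <ᵇ⇒< x y (Equivalence.from T-≡ eq)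

alternating-reverse : ∀ {P : ℕ → Set} (f : ℕ → ℕ) → (∀ {x y} → P x → P y → x < y → f y < f x) →
                      ∀ up σ → All P σ → alternatingFrom up σ ≡ true → alternatingFrom (not up) (map f σ) ≡ true
alternating-reverse f rev up [] _ _ = refl
alternating-reverse f rev up (x ∷ []) _ _ = refl
alternating-reverse f rev true (x ∷ y ∷ ys) (px ∷ py ∷ ps) alt =
  cong₂ _∧_ (<ᵇ⁺ (rev px py (<ᵇ⁻ {x} (∧-conicalˡ _ _ alt)))) (alternating-reverse f rev false (y ∷ ys) (py ∷ ps) (∧-conicalʳ (x <ᵇ y) _ alt))
alternating-reverse f rev false (x ∷ y ∷ ys) (px ∷ py ∷ ps) alt =
  cong₂ _∧_ (<ᵇ⁺ (rev py px (<ᵇ⁻ {y} (∧-conicalˡ _ _ alt)))) (alternating-reverse f rev true (y ∷ ys) (py ∷ ps) (∧-conicalʳ (y <ᵇ x) _ alt))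

-- The order reversing bijection from {1,…,n} to {1,…,n+1} ∖ {k}.
flip∖ : ℕ → ℕ → ℕ → ℕ
flip∖ n k y with k ≤? suc n ∸ y
... | yes _ = suc (suc n ∸ y)
... | no  _ = suc n ∸ y

flip∖-< : ∀ {n k x y} → y ≤ n → x < y → flip∖ n k y < flip∖ n k x
flip∖-< {n} {k} {x} {y} y≤n x<y with k ≤? suc n ∸ y | k ≤? suc n ∸ x | ∸-monoʳ-< x<y (m≤n⇒m≤1+n y≤n)
... | yes _   | yes _   | lt = s≤s lt
... | yes k≤y | no  k≰x | lt = contradiction (≤-trans k≤y (<⇒≤ lt)) k≰x
... | no  _   | yes _   | lt = m<n⇒m<1+n lt
... | no  _   | no  _   | lt = lt

flip∖-≢ : ∀ {n k y} → flip∖ n k y ≢ k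
flip∖-≢ {n} {k} {y} eq with k ≤? suc n ∸ y
... | yes k≤ = <⇒≢ (s≤s k≤) (sym eq)
... | no  k≰ = k≰ (≤-reflexive (sym eq))

flip∖-range : ∀ {n k y} → 1 ≤ y → y ≤ n → 1 ≤ flip∖ n k y × flip∖ n k y ≤ suc n
flip∖-range {n} {k} {suc y} _ y≤n with k ≤? n ∸ y
... | yes _ = s≤s z≤n , s≤s (m∸n≤m n y)
... | no  _ = m<n⇒0<n∸m y≤n , m≤n⇒m≤1+n (m∸n≤m n y)

flip∖-injective : ∀ {n k x y} → x ≤ n → y ≤ n → flip∖ n k x ≡ flip∖ n k y → x ≡ y
flip∖-injective {n} {k} {x} {y} x≤n y≤n eq with <-cmp x y
... | tri< x<y _ _ = contradiction (sym eq) (<⇒≢ (flip∖-< {n} {k} y≤n x<y))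
... | tri≈ _ x≡y _ = x≡y
... | tri> _ _ y<x = contradiction eq (<⇒≢ (flip∖-< {n} {k} x≤n y<x))

map-injective-on : ∀ {P : ℕ → Set} {f : ℕ → ℕ} → (∀ {x y} → P x → P y → f x ≡ f y → x ≡ y) →
                   ∀ {xs ys} → All P xs → All P ys → map f xs ≡ map f ys → xs ≡ ys
map-injective-on inj [] [] eq = refl
map-injective-on inj (px ∷ pxs) (py ∷ pys) eq =
  cong₂ _∷_ (inj px py (proj₁ (∷-injective eq))) (map-injective-on inj pxs pys (proj₂ (∷-injective eq)))

-- The flag tells whether the first two entries were exchanged; it makes the map injective and costs
-- the factor 2 in `zigzag-growth`.
prepend : ℕ → List ℕ → Bool × List ℕ
prepend k [] = true , k ∷ []
prepend k (t ∷ ts) = if k <ᵇ t then (true , k ∷ t ∷ ts) else (false , t ∷ k ∷ ts)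

prepend-injective : ∀ {k l ss ts} → prepend k ss ≡ prepend l ts → k ≡ l × ss ≡ ts
prepend-injective {ss = []} {[]} refl = refl , refl
prepend-injective {l = l} {[]} {t ∷ ts} eq with l <ᵇ t | eq
... | true  | ()
... | false | ()
prepend-injective {k} {ss = s ∷ ss} {[]} eq with k <ᵇ s | eq
... | true  | ()
... | false | ()
prepend-injective {k} {l} {s ∷ ss} {t ∷ ts} eq with k <ᵇ s | l <ᵇ t | eq
... | true  | true  | refl = refl , refl
... | false | false | refl = refl , refl

prepend-alternating : ∀ {k} τ → k ∉ τ → alternatingFrom false τ ≡ true → alternatingFrom true (proj₂ (prepend k τ)) ≡ true
prepend-alternating [] _ _ = refl
prepend-alternating {k} (t ∷ ts) k∉ alt with k <ᵇ t in eq
... | true rewrite eq = alt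
... | false = cong₂ _∧_ (<ᵇ⁺ t<k) (below ts alt)
  where
  t<k : t < k
  t<k with <-cmp k t
  ... | tri< k<t _ _ = case trans (sym eq) (<ᵇ⁺ k<t) of λ ()
  ... | tri≈ _ k≡t _ = contradiction (here k≡t) k∉
  ... | tri> _ _ t<k = t<k
  -- The entry after `t` is below `t`, hence below `k`, so the larger `k` can take the place of `t`.
  below : ∀ ts → alternatingFrom false (t ∷ ts) ≡ true → alternatingFrom false (k ∷ ts) ≡ true
  below [] _ = refl
  below (u ∷ us) alt′ = cong₂ _∧_ (<ᵇ⁺ (<-trans (<ᵇ⁻ {u} (∧-conicalˡ _ _ alt′)) t<k)) (∧-conicalʳ (u <ᵇ t) _ alt′)

prepend-rearrangement : ∀ {xs k} τ → Rearrangement xs (k ∷ τ) → Rearrangement xs (proj₂ (prepend k τ))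
prepend-rearrangement [] r = r
prepend-rearrangement {k = k} (t ∷ ts) r@(rearrangement ((k≢t ∷ k∉) ∷ t∉ ∷ u) s z) with k <ᵇ t
... | true = r
... | false = rearrangement ((k≢t ∘ sym ∷ t∉) ∷ k∉ ∷ u)
  (λ { (here p) → s (there (here p)) ; (there (here p)) → s (here p) ; (there (there p)) → s (there (there p)) }) z

zigzag-growth : ∀ n → suc n * zigzag n ≤ 2 * zigzag (suc n)
zigzag-growth n = begin
  suc n * zigzag n ≡⟨ cong (_* zigzag n) (length-applyUpTo suc (suc n)) ⟨
  length (range (suc n)) * length (zigzags n) ≡⟨ length-cartesianProduct (range (suc n)) (zigzags n) ⟨
  length pairs ≤⟨ AtMost-injective {P = _∈ pairs} extend extend∈ extend-injective (AtMost-∈ images) pairs unique-pairs (All.tabulate id) ⟩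
  length images ≡⟨ length-cartesianProduct (true ∷ false ∷ []) (zigzags (suc n)) ⟩
  2 * zigzag (suc n) ∎
  where
  open ≤-Reasoning
  pairs : List (ℕ × List ℕ)
  pairs = cartesianProduct (range (suc n)) (zigzags n)
  images : List (Bool × List ℕ)
  images = cartesianProduct (true ∷ false ∷ []) (zigzags (suc n))
  extend : ℕ × List ℕ → Bool × List ℕ
  extend (k , σ) = prepend k (map (flip∖ n k) σ)

  unique-pairs : Unique pairs
  unique-pairs = Unique.cartesianProduct⁺ (unique-range (suc n)) (Unique.filter⁺ _ (unique-perms (unique-range n)))

  zigzags⁻ : ∀ {σ} → σ ∈ zigzags n → Rearrangement (range n) σ × alternatingFrom true σ ≡ true
  zigzags⁻ σ∈ with ∈-filter⁻ (λ σ → alternatingFrom true σ ≟B true) {xs = perms (range n)} σ∈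
  ... | σ∈perms , alt = perms⇒rearrangement (unique-range n) σ∈perms , alt

  bounded : ∀ {σ} → Rearrangement (range n) σ → All (λ y → 1 ≤ y × y ≤ n) σ
  bounded r = All.tabulate (∈-range⁻ ∘ Rearrangement.support r)

  bool∈ : ∀ b → b ∈ true ∷ false ∷ []
  bool∈ true = here refl
  bool∈ false = there (here refl)

  k∉ : ∀ {k} σ → k ∉ map (flip∖ n k) σ
  k∉ {k} σ k∈ with ∈-map⁻ (flip∖ n k) k∈
  ... | y , _ , eq = flip∖-≢ {n} {k} {y} (sym eq)

  extended : ∀ {k σ} → k ∈ range (suc n) → Rearrangement (range n) σ → Rearrangement (range (suc n)) (k ∷ map (flip∖ n k) σ)
  extended {k} {σ} k∈ r@(rearrangement u s z) = rearrangement
    (All.tabulate (λ y∈ k≡y → k∉ σ (subst (_∈ _) (sym k≡y) y∈)) ∷ unique-map (bounded r) u)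
    (λ { (here refl) → k∈ ; (there y∈) → case ∈-map⁻ (flip∖ n k) y∈ of λ { (x , x∈ , refl) →
         let lo , hi = All.lookup (bounded r) x∈ ; lo′ , hi′ = flip∖-range {n} {k} lo hi in ∈-range⁺ lo′ hi′ } })
    (trans (cong suc (trans (length-map _ σ) (trans z (length-applyUpTo suc n)))) (sym (length-applyUpTo suc (suc n))))
    where
    unique-map : ∀ {τ} → All (λ y → 1 ≤ y × y ≤ n) τ → Unique τ → Unique (map (flip∖ n k) τ)
    unique-map [] [] = []
    unique-map (b ∷ bs) (y∉ ∷ uτ) =
      All.map⁺ (All.zipWith (λ ((_ , hi) , y≢z) eq → y≢z (flip∖-injective {n} {k} (proj₂ b) hi eq)) (bs , y∉)) ∷ unique-map bs uτ

  extend∈ : ∀ {x} → x ∈ pairs → extend x ∈ images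
  extend∈ {k , σ} x∈ with ∈-cartesianProduct⁻ (range (suc n)) (zigzags n) x∈
  ... | k∈ , σ∈ with zigzags⁻ σ∈
  ... | r , alt = ∈-cartesianProduct⁺ (bool∈ _)
    (∈-filter⁺ (λ σ → alternatingFrom true σ ≟B true)
      (rearrangement⇒perms (prepend-rearrangement _ (extended k∈ r)))
      (prepend-alternating _ (k∉ σ) (alternating-reverse (flip∖ n k) (λ _ q → flip∖-< {n} {k} (proj₂ q)) true σ (bounded r) alt)))

  extend-injective : ∀ {x y} → x ∈ pairs → y ∈ pairs → extend x ≡ extend y → x ≡ y
  extend-injective {k , σ} {l , τ} x∈ y∈ eq with prepend-injective {k} {l} {map (flip∖ n k) σ} {map (flip∖ n l) τ} eq
  ... | refl , eq′ = cong (k ,_) (map-injective-on (λ p q → flip∖-injective {n} {k} (proj₂ p) (proj₂ q))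
    (bounded (proj₁ (zigzags⁻ (proj₂ (∈-cartesianProduct⁻ (range (suc n)) (zigzags n) x∈)))))
    (bounded (proj₁ (zigzags⁻ (proj₂ (∈-cartesianProduct⁻ (range (suc n)) (zigzags n) y∈))))) eq′)

-- The bounds β and γ

prodFact-∣ : ∀ ks → prodFact ks ∣ (sum ks) !
prodFact-∣ [] = ∣-refl
prodFact-∣ (k ∷ ks) = ∣-trans (*-monoʳ-∣ (k !) (prodFact-∣ ks))
  (subst (λ j → k ! * j ! ∣ (k + sum ks) !) (m+n∸m≡n k (sum ks)) (k![n∸k]!∣n! (m≤m+n k (sum ks))))

multinomial-* : ∀ ks → multinomial (sum ks) ks * prodFact ks ≡ (sum ks) !
multinomial-* ks = m/n*n≡m {{prodFact≢0 ks}} (prodFact-∣ ks)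

C-* : ∀ k j → ((k + j) C k) * (k ! * j !) ≡ (k + j) !
C-* k j = begin
  ((k + j) C k) * (k ! * j !)              ≡⟨ cong (λ i → ((k + j) C k) * (k ! * i !)) (m+n∸m≡n k j) ⟨
  ((k + j) C k) * (k ! * (k + j ∸ k) !)    ≡⟨ cong (_* (k ! * (k + j ∸ k) !)) (nCk≡n!/k![n-k]! (m≤m+n k j)) ⟩
  _                                        ≡⟨ m/n*n≡m {{_}} (k![n∸k]!∣n! (m≤m+n k j)) ⟩
  (k + j) !                                ∎
  where open ≡-Reasoning

-- Both `β` and `γ` have this form. When the parts sum to M - k all divisions are exact, and
-- clearing the denominators turns comparisons into ones between products of factorials.
arrangements-* : ∀ A M k ks → k + sum ks ≡ M →
                 A * (M C k) * multinomial (M ∸ k) ks * (k ! * prodFact ks) ≡ A * M !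
arrangements-* A M k ks refl = begin
  A * (M C k) * multinomial (M ∸ k) ks * (k ! * prodFact ks)
    ≡⟨ cong (λ i → A * (M C k) * multinomial i ks * (k ! * prodFact ks)) (m+n∸m≡n k (sum ks)) ⟩
  A * (M C k) * multinomial (sum ks) ks * (k ! * prodFact ks)
    ≡⟨ shuffle A (M C k) (multinomial (sum ks) ks) (k !) (prodFact ks) ⟩
  A * ((M C k) * (k ! * (multinomial (sum ks) ks * prodFact ks)))
    ≡⟨ cong (λ i → A * ((M C k) * (k ! * i))) (multinomial-* ks) ⟩
  A * ((M C k) * (k ! * (sum ks) !))
    ≡⟨ cong (A *_) (C-* k (sum ks)) ⟩
  A * M ! ∎
  where
  open ≡-Reasoning
  shuffle : ∀ a b c d e → a * b * c * (d * e) ≡ a * (b * (d * (c * e)))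
  shuffle = solve-∀

-- The common tail of `betaParts` and `gammaParts`.
smallParts : ℕ → List ℕ
smallParts k = map (λ j → 2 ^ (1 + j) ∸ 1) (upTo k)

smallParts-∷ʳ : ∀ k → smallParts (suc k) ≡ smallParts k ∷ʳ (2 ^ suc k ∸ 1)
smallParts-∷ʳ k = begin
  map f (upTo (suc k))        ≡⟨ map-upTo f (suc k) ⟩
  applyUpTo f (suc k)         ≡⟨ applyUpTo-∷ʳ f k ⟨
  applyUpTo f k ∷ʳ f k        ≡⟨ cong (_∷ʳ f k) (map-upTo f k) ⟨
  map f (upTo k) ∷ʳ f k       ∎
  where
  open ≡-Reasoning
  f = λ j → 2 ^ (1 + j) ∸ 1

prodFact-++ : ∀ ks ls → prodFact (ks ++ ls) ≡ prodFact ks * prodFact ls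
prodFact-++ [] ls = sym (+-identityʳ _)
prodFact-++ (k ∷ ks) ls = trans (cong (k ! *_) (prodFact-++ ks ls)) (sym (*-assoc (k !) (prodFact ks) (prodFact ls)))

sum-smallParts : ∀ k → sum (smallParts k) + (2 + k) ≡ 2 ^ suc k
sum-smallParts zero = refl
sum-smallParts (suc k) = begin
  sum (smallParts (suc k)) + (3 + k)           ≡⟨ cong (λ ks → sum ks + (3 + k)) (smallParts-∷ʳ k) ⟩
  sum (smallParts k ∷ʳ x) + (3 + k)            ≡⟨ cong (_+ (3 + k)) (sum-++ (smallParts k) [ x ]) ⟩
  sum (smallParts k) + (x + 0) + (3 + k)       ≡⟨ shuffle (sum (smallParts k)) x k ⟩
  sum (smallParts k) + (2 + k) + (1 + x)       ≡⟨ cong₂ _+_ (sum-smallParts k) (m+[n∸m]≡n (m^n>0 2 (suc k))) ⟩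
  2 ^ suc k + 2 ^ suc k                        ≡⟨ cong (2 ^ suc k +_) (+-identityʳ (2 ^ suc k)) ⟨
  2 ^ suc (suc k)                              ∎
  where
  open ≡-Reasoning
  x = 2 ^ suc k ∸ 1
  shuffle : ∀ s x k → s + (x + 0) + (3 + k) ≡ s + (2 + k) + (1 + x)
  shuffle = solve-∀

-- With 2 ^ (2 + j) = 2 + q all the quantities below become polynomials in q, free of truncated subtraction.
module _ (j q : ℕ) (2^[2+j] : 2 ^ (2 + j) ≡ 2 + q) where

  2^[3+j] : 2 ^ (3 + j) ≡ 4 + 2 * q
  2^[3+j] = trans (cong (2 *_) 2^[2+j]) (eq q)
    where eq : ∀ q → 2 * (2 + q) ≡ 4 + 2 * q
          eq = solve-∀
  2^[4+j] : 2 ^ (4 + j) ≡ 8 + 4 * q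
  2^[4+j] = trans (cong (2 *_) 2^[3+j]) (eq q)
    where eq : ∀ q → 2 * (4 + 2 * q) ≡ 8 + 4 * q
          eq = solve-∀
  2^[5+j] : 2 ^ (5 + j) ≡ 16 + 8 * q
  2^[5+j] = trans (cong (2 *_) 2^[4+j]) (eq q)
    where eq : ∀ q → 2 * (8 + 4 * q) ≡ 16 + 8 * q
          eq = solve-∀
  private
    S = sum (smallParts (1 + j))
    S≡ : S + (3 + j) ≡ 2 + q
    S≡ = trans (sum-smallParts (1 + j)) 2^[2+j]
    prodFact-small : prodFact (smallParts (2 + j)) ≡ prodFact (smallParts (1 + j)) * (suc q) !
    prodFact-small = trans (cong prodFact (smallParts-∷ʳ (1 + j)))
      (trans (prodFact-++ (smallParts (1 + j)) _)
        (cong (prodFact (smallParts (1 + j)) *_) (trans (*-identityʳ _) (cong (λ x → (x ∸ 1) !) 2^[2+j]))))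
    sum-small : sum (smallParts (2 + j)) + (4 + j) ≡ 4 + 2 * q
    sum-small = trans (sum-smallParts (2 + j)) 2^[3+j]
    Q = prodFact (smallParts (1 + j))

  β₄₊-* : β (4 + j) * ((4 + j) ! * ((2 + 2 * q) ! * (q ! * Q))) ≡ zigzag (4 + j) * (5 + 4 * q) !
  β₄₊-* = trans (cong (λ x → β (4 + j) * ((4 + j) ! * x)) (sym (cong prodFact parts)))
    (trans (arrangements-* (zigzag (4 + j)) (2 ^ (4 + j) ∸ 3) (4 + j) (betaParts (4 + j)) total)
      (cong (λ x → zigzag (4 + j) * (x ∸ 3) !) 2^[4+j]))
    where
    parts : betaParts (4 + j) ≡ (2 + 2 * q) ∷ q ∷ smallParts (1 + j)
    parts = cong₂ (λ x y → x ∷ y ∷ smallParts (1 + j)) (cong (_∸ 2) 2^[3+j]) (cong (_∸ 2) 2^[2+j])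
    total : 4 + j + sum (betaParts (4 + j)) ≡ 2 ^ (4 + j) ∸ 3
    total = trans (cong (λ ks → 4 + j + sum ks) parts) (trans (eq j q S) (trans (cong (λ x → 3 + 3 * q + x) S≡) (trans (eq′ q) (cong (_∸ 3) (sym 2^[4+j])))))
      where
      eq : ∀ j q S → 4 + j + (2 + 2 * q + (q + S)) ≡ 3 + 3 * q + (S + (3 + j))
      eq = solve-∀
      eq′ : ∀ q → 3 + 3 * q + (2 + q) ≡ 5 + 4 * q
      eq′ = solve-∀

  β₅₊-* : β (5 + j) * ((5 + j) ! * ((6 + 4 * q) ! * ((2 + 2 * q) ! * (Q * (suc q) !)))) ≡ zigzag (5 + j) * (13 + 8 * q) !
  β₅₊-* = trans (cong (λ x → β (5 + j) * ((5 + j) ! * x)) (sym parts!))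
    (trans (arrangements-* (zigzag (5 + j)) (2 ^ (5 + j) ∸ 3) (5 + j) (betaParts (5 + j)) total)
      (cong (λ x → zigzag (5 + j) * (x ∸ 3) !) 2^[5+j]))
    where
    parts : betaParts (5 + j) ≡ (6 + 4 * q) ∷ (2 + 2 * q) ∷ smallParts (2 + j)
    parts = cong₂ (λ x y → x ∷ y ∷ smallParts (2 + j)) (cong (_∸ 2) 2^[4+j]) (cong (_∸ 2) 2^[3+j])
    parts! : prodFact (betaParts (5 + j)) ≡ (6 + 4 * q) ! * ((2 + 2 * q) ! * (Q * (suc q) !))
    parts! = trans (cong prodFact parts) (cong (λ x → (6 + 4 * q) ! * ((2 + 2 * q) ! * x)) prodFact-small)
    total : 5 + j + sum (betaParts (5 + j)) ≡ 2 ^ (5 + j) ∸ 3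
    total = trans (cong (λ ks → 5 + j + sum ks) parts) (trans (eq j q _) (trans (cong (9 + 6 * q +_) sum-small) (trans (eq′ q) (cong (_∸ 3) (sym 2^[5+j])))))
      where
      eq : ∀ j q S → 5 + j + (6 + 4 * q + (2 + 2 * q + S)) ≡ 9 + 6 * q + (S + (4 + j))
      eq = solve-∀
      eq′ : ∀ q → 9 + 6 * q + (4 + 2 * q) ≡ 13 + 8 * q
      eq′ = solve-∀

  γ₅₊-* : γ (5 + j) * ((5 + j) ! * ((5 + 4 * q) ! * ((1 + 2 * q) ! * (Q * (suc q) !)))) ≡ zigzag (5 + j) * (11 + 8 * q) !
  γ₅₊-* = trans (cong (λ x → γ (5 + j) * ((5 + j) ! * x)) (sym parts!))
    (trans (arrangements-* (zigzag (5 + j)) (2 ^ (5 + j) ∸ 5) (5 + j) (gammaParts (5 + j)) total)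
      (cong (λ x → zigzag (5 + j) * (x ∸ 5) !) 2^[5+j]))
    where
    parts : gammaParts (5 + j) ≡ (5 + 4 * q) ∷ (1 + 2 * q) ∷ smallParts (2 + j)
    parts = cong₂ (λ x y → x ∷ y ∷ smallParts (2 + j)) (cong (_∸ 3) 2^[4+j]) (cong (_∸ 3) 2^[3+j])
    parts! : prodFact (gammaParts (5 + j)) ≡ (5 + 4 * q) ! * ((1 + 2 * q) ! * (Q * (suc q) !))
    parts! = trans (cong prodFact parts) (cong (λ x → (5 + 4 * q) ! * ((1 + 2 * q) ! * x)) prodFact-small)
    total : 5 + j + sum (gammaParts (5 + j)) ≡ 2 ^ (5 + j) ∸ 5
    total = trans (cong (λ ks → 5 + j + sum ks) parts) (trans (eq j q _) (trans (cong (7 + 6 * q +_) sum-small) (trans (eq′ q) (cong (_∸ 5) (sym 2^[5+j])))))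
      where
      eq : ∀ j q S → 5 + j + (5 + 4 * q + (1 + 2 * q + S)) ≡ 7 + 6 * q + (S + (4 + j))
      eq = solve-∀
      eq′ : ∀ q → 7 + 6 * q + (4 + 2 * q) ≡ 11 + 8 * q
      eq′ = solve-∀

  module _ (μ : ℕ) (μ-* : μ * ((6 + 4 * q) ! * (6 + 4 * q) !) ≡ (13 + 8 * q) !) where

    -- With n = 5 + j, the right side divided by the left is (6 + 4 q) / (1 + q) times A_n / (n
    -- A_(n-1)), and the last quotient is at least 1/2.
    β-growth : μ * β (4 + j) ≤ β (5 + j)
    β-growth = *-cancelʳ-≤ _ _ K {{K≢0}} (begin
      μ * β (4 + j) * K
        ≡⟨ shuffle₁ μ (β (4 + j)) (5 + j) ((4 + j) !) f g Q (suc q) (q !) ⟩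
      μ * (f * f) * (β (4 + j) * ((4 + j) ! * (g * (q ! * Q)))) * ((5 + j) * suc q)
        ≡⟨ cong₂ (λ x y → x * y * ((5 + j) * suc q)) μ-* β₄₊-* ⟩
      F * (zigzag (4 + j) * e) * ((5 + j) * suc q)
        ≡⟨ shuffle₂ F (zigzag (4 + j)) e (5 + j) (suc q) ⟩
      F * e * suc q * ((5 + j) * zigzag (4 + j))
        ≤⟨ *-monoʳ-≤ (F * e * suc q) (zigzag-growth (4 + j)) ⟩
      F * e * suc q * (2 * zigzag (5 + j))
        ≤⟨ ≤-trans (m≤m+n _ _) (≤-reflexive (shuffle₃ F e q (zigzag (5 + j)))) ⟩
      zigzag (5 + j) * F * ((6 + 4 * q) * e)
        ≡⟨ cong (_* ((6 + 4 * q) * e)) β₅₊-* ⟨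
      β (5 + j) * ((5 + j) * (4 + j) ! * (f * (g * (Q * (suc q * q !))))) * f
        ≡⟨ shuffle₄ (β (5 + j)) (5 + j) ((4 + j) !) f g Q (suc q) (q !) ⟩
      β (5 + j) * K ∎)
      where
      open ≤-Reasoning
      f = (6 + 4 * q) !
      g = (2 + 2 * q) !
      F = (13 + 8 * q) !
      e = (5 + 4 * q) !
      K = (5 + j) ! * (f * f * (g * (Q * (suc q) !)))
      K≢0 : NonZero K
      K≢0 = m*n≢0 ((5 + j) !) _ {{(5 + j) !≢0}} {{m*n≢0 (f * f) _ {{m*n≢0 f f {{(6 + 4 * q) !≢0}} {{(6 + 4 * q) !≢0}}}}
              {{m*n≢0 g _ {{(2 + 2 * q) !≢0}} {{m*n≢0 Q _ {{prodFact≢0 (smallParts (1 + j))}} {{(suc q) !≢0}}}}}}}}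
      shuffle₁ : ∀ μ b n N f g Q t h → μ * b * (n * N * (f * f * (g * (Q * (t * h))))) ≡ μ * (f * f) * (b * (N * (g * (h * Q)))) * (n * t)
      shuffle₁ = solve-∀
      shuffle₂ : ∀ F z e n t → F * (z * e) * (n * t) ≡ F * e * t * (n * z)
      shuffle₂ = solve-∀
      shuffle₃ : ∀ F e q z → F * e * suc q * (2 * z) + F * e * z * (4 + 2 * q) ≡ z * F * ((6 + 4 * q) * e)
      shuffle₃ = solve-∀
      shuffle₄ : ∀ b n N f g Q t h → b * (n * N * (f * (g * (Q * (t * h))))) * f ≡ b * (n * N * (f * f * (g * (Q * (t * h)))))
      shuffle₄ = solve-∀

  module _ (ν : ℕ) (ν-* : ν * ((5 + 4 * q) ! * (5 + 4 * q) !) ≡ (11 + 8 * q) !) where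

    -- The quotient of the two sides is exactly 2 A_n / (n A_(n-1)) with n = 5 + j: everything else
    -- cancels, so the zigzag inequality is just what is needed.
    γ-growth : ν * β (4 + j) ≤ γ (5 + j)
    γ-growth = *-cancelʳ-≤ _ _ K {{K≢0}} (begin
      ν * β (4 + j) * K
        ≡⟨ shuffle₁ ν (β (4 + j)) (5 + j) ((4 + j) !) e ((2 + 2 * q) !) Q (suc q) (q !) ⟩
      ν * (e * e) * (β (4 + j) * ((4 + j) ! * ((2 + 2 * q) ! * (q ! * Q)))) * ((5 + j) * suc q)
        ≡⟨ cong₂ (λ x y → x * y * ((5 + j) * suc q)) ν-* β₄₊-* ⟩
      G * (zigzag (4 + j) * e) * ((5 + j) * suc q)
        ≡⟨ shuffle₂ G (zigzag (4 + j)) e (5 + j) (suc q) ⟩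
      G * e * suc q * ((5 + j) * zigzag (4 + j))
        ≤⟨ *-monoʳ-≤ (G * e * suc q) (zigzag-growth (4 + j)) ⟩
      G * e * suc q * (2 * zigzag (5 + j))
        ≡⟨ shuffle₃ G e q (zigzag (5 + j)) ⟩
      zigzag (5 + j) * G * ((2 + 2 * q) * e)
        ≡⟨ cong (_* ((2 + 2 * q) * e)) γ₅₊-* ⟨
      γ (5 + j) * ((5 + j) * (4 + j) ! * (e * (g * (Q * (suc q * q !))))) * ((2 + 2 * q) * e)
        ≡⟨ shuffle₄ (γ (5 + j)) (5 + j) ((4 + j) !) e g Q (suc q) (q !) (2 + 2 * q) ⟩
      γ (5 + j) * K ∎)
      where
      open ≤-Reasoning
      g = (1 + 2 * q) !
      G = (11 + 8 * q) !
      e = (5 + 4 * q) !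
      K = (5 + j) ! * (e * e * ((2 + 2 * q) ! * (Q * (suc q) !)))
      K≢0 : NonZero K
      K≢0 = m*n≢0 ((5 + j) !) _ {{(5 + j) !≢0}} {{m*n≢0 (e * e) _ {{m*n≢0 e e {{(5 + 4 * q) !≢0}} {{(5 + 4 * q) !≢0}}}}
              {{m*n≢0 ((2 + 2 * q) !) _ {{(2 + 2 * q) !≢0}} {{m*n≢0 Q _ {{prodFact≢0 (smallParts (1 + j))}} {{(suc q) !≢0}}}}}}}}
      shuffle₁ : ∀ μ b n N f g Q t h → μ * b * (n * N * (f * f * (g * (Q * (t * h))))) ≡ μ * (f * f) * (b * (N * (g * (h * Q)))) * (n * t)
      shuffle₁ = solve-∀
      shuffle₂ : ∀ F z e n t → F * (z * e) * (n * t) ≡ F * e * t * (n * z)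
      shuffle₂ = solve-∀
      shuffle₃ : ∀ F e q z → F * e * suc q * (2 * z) ≡ z * F * ((2 + 2 * q) * e)
      shuffle₃ = solve-∀
      shuffle₄ : ∀ b n N e g Q t h s → b * (n * N * (e * (g * (Q * (t * h))))) * (s * e) ≡ b * (n * N * (e * e * (s * g * (Q * (t * h)))))
      shuffle₄ = solve-∀

-- From one ℓ to the next all exponents double and a new β enters to the first power. Squaring
-- `TBound (4 + j)` gives two factors `β (4 + j)`: one is absorbed here, the other goes into
-- `β-growth` or `γ-growth`.
commonFactor-suc : ∀ j → commonFactor (5 + j) ≡ commonFactor (4 + j) * commonFactor (4 + j) * β (4 + j)
commonFactor-suc j = begin
  10 ^ (2 ^ suc j) * product (map (λ i → b i ^ (2 ^ (j ∸ i))) (upTo (suc j)))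
    ≡⟨ cong₂ _*_ (double 10 j) (trans (cong product (map-upTo (λ i → b i ^ (2 ^ (j ∸ i))) (suc j))) (squares b j)) ⟩
  10 ^ (2 ^ j) * 10 ^ (2 ^ j) * (P * P * b j)
    ≡⟨ cong (λ p → 10 ^ (2 ^ j) * 10 ^ (2 ^ j) * (p * p * b j)) (cong product (map-upTo (λ i → b i ^ (2 ^ (j ∸ suc i))) j)) ⟨
  10 ^ (2 ^ j) * 10 ^ (2 ^ j) * (P′ * P′ * b j)
    ≡⟨ shuffle (10 ^ (2 ^ j)) P′ (b j) ⟩
  10 ^ (2 ^ j) * P′ * (10 ^ (2 ^ j) * P′) * b j ∎
  where
  open ≡-Reasoning
  b : ℕ → ℕ
  b i = β (4 + i)
  P P′ : ℕ
  P = product (applyUpTo (λ i → b i ^ (2 ^ (j ∸ suc i))) j)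
  P′ = product (map (λ i → b i ^ (2 ^ (j ∸ suc i))) (upTo j))
  shuffle : ∀ t p c → t * t * (p * p * c) ≡ t * p * (t * p) * c
  shuffle = solve-∀
  double : ∀ c k → c ^ (2 ^ suc k) ≡ c ^ (2 ^ k) * c ^ (2 ^ k)
  double c k = trans (cong (λ x → c ^ (2 ^ k + x)) (+-identityʳ (2 ^ k))) (^-distribˡ-+-* c (2 ^ k) (2 ^ k))
  squares : ∀ (b : ℕ → ℕ) j → product (applyUpTo (λ i → b i ^ (2 ^ (j ∸ i))) (suc j)) ≡
    product (applyUpTo (λ i → b i ^ (2 ^ (j ∸ suc i))) j) * product (applyUpTo (λ i → b i ^ (2 ^ (j ∸ suc i))) j) * b j
  squares b zero = eq (b 0)
    where eq : ∀ x → x * 1 * 1 ≡ x + 0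
          eq = solve-∀
  squares b (suc j) = trans (cong₂ _*_ (double (b 0) j) (squares (b ∘ suc) j)) (eq (b 0 ^ (2 ^ j)) _ (b (suc j)))
    where eq : ∀ x p c → x * x * (p * p * c) ≡ x * p * (x * p) * c
          eq = solve-∀

-- Chip counts

δ : Vertex → Vertex → ℕ
δ w v = if does (w ≟V v) then 1 else 0

δ-refl : ∀ v → δ v v ≡ 1
δ-refl v with v ≟V v
... | yes _  = refl
... | no v≢v = contradiction refl v≢v

δ-≢ : ∀ {w v} → w ≢ v → δ w v ≡ 0
δ-≢ {w} {v} w≢v with w ≟V v
... | yes w≡v = contradiction w≡v w≢v
... | no _    = refl

δ-∷ : ∀ s w v → δ (s ∷ w) (s ∷ v) ≡ δ w v
δ-∷ s w v = go (w ≟V v)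
  where
  go : Dec (w ≡ v) → δ (s ∷ w) (s ∷ v) ≡ δ w v
  go (yes refl) = trans (δ-refl (s ∷ w)) (sym (δ-refl w))
  go (no w≢v)   = trans (δ-≢ {s ∷ w} {s ∷ v} (w≢v ∘ ∷-injectiveʳ)) (sym (δ-≢ w≢v))

δ-sym : ∀ w v → δ w v ≡ δ v w
δ-sym w v = go (w ≟V v)
  where
  go : Dec (w ≡ v) → δ w v ≡ δ v w
  go (yes refl) = refl
  go (no w≢v)   = trans (δ-≢ w≢v) (sym (δ-≢ (w≢v ∘ sym)))

chipsAt-∷ : ∀ {N} w (c : Config N) v → chipsAt (w ∷ c) v ≡ δ w v + chipsAt c v
chipsAt-∷ w c v with w ≟V v
... | yes _ = refl
... | no  _ = refl

chipsAt-update : ∀ {N} (c : Config N) i w v → chipsAt (c [ i ]≔ w) v + δ (lookup c i) v ≡ chipsAt c v + δ w v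
chipsAt-update (u ∷ c) zero w v rewrite chipsAt-∷ w c v | chipsAt-∷ u c v = swap (δ w v) (chipsAt c v) (δ u v)
  where swap : ∀ a b c → a + b + c ≡ c + b + a
        swap = solve-∀
chipsAt-update (u ∷ c) (suc i) w v rewrite chipsAt-∷ u (c [ i ]≔ w) v | chipsAt-∷ u c v =
  trans (+-assoc (δ u v) _ _) (trans (cong (δ u v +_) (chipsAt-update c i w v)) (sym (+-assoc (δ u v) _ _)))

chipsAt-lookup : ∀ {N} (c : Config N) i {v} → lookup c i ≡ v → 1 ≤ chipsAt c v
chipsAt-lookup (u ∷ c) zero {v} refl rewrite chipsAt-∷ u c v | δ-refl u = s≤s z≤n
chipsAt-lookup (u ∷ c) (suc i) {v} eq rewrite chipsAt-∷ u c v = ≤-trans (chipsAt-lookup c i eq) (m≤n+m _ (δ u v))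

chipsAt-update₃ : ∀ {N} (c : Config N) {x i j k} → i ≢ j → i ≢ k → j ≢ k →
                  lookup c i ≡ x → lookup c j ≡ x → lookup c k ≡ x → ∀ u₁ u₂ u₃ v →
                  chipsAt (c [ i ]≔ u₁ [ j ]≔ u₂ [ k ]≔ u₃) v + 3 * δ x v ≡ chipsAt c v + (δ u₁ v + δ u₂ v + δ u₃ v)
chipsAt-update₃ c {x} {i} {j} {k} i≢j i≢k j≢k refl atj atk u₁ u₂ u₃ v = begin
  chipsAt c₃ v + 3 * δ x v
    ≡⟨ regroup₁ (chipsAt c₃ v) (δ x v) ⟩
  (chipsAt c₃ v + δ x v) + δ x v + δ x v
    ≡⟨ cong (λ w → (chipsAt c₃ v + δ w v) + δ x v + δ x v) at₂k ⟨
  (chipsAt c₃ v + δ (lookup c₂ k) v) + δ x v + δ x v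
    ≡⟨ cong (λ n → n + δ x v + δ x v) (chipsAt-update c₂ k u₃ v) ⟩
  chipsAt c₂ v + δ u₃ v + δ x v + δ x v
    ≡⟨ regroup₂ (chipsAt c₂ v) (δ u₃ v) (δ x v) ⟩
  (chipsAt c₂ v + δ x v) + δ x v + δ u₃ v
    ≡⟨ cong (λ w → (chipsAt c₂ v + δ w v) + δ x v + δ u₃ v) at₁j ⟨
  (chipsAt c₂ v + δ (lookup c₁ j) v) + δ x v + δ u₃ v
    ≡⟨ cong (λ n → n + δ x v + δ u₃ v) (chipsAt-update c₁ j u₂ v) ⟩
  chipsAt c₁ v + δ u₂ v + δ x v + δ u₃ v
    ≡⟨ regroup₃ (chipsAt c₁ v) (δ u₂ v) (δ x v) (δ u₃ v) ⟩
  (chipsAt c₁ v + δ x v) + (δ u₂ v + δ u₃ v)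
    ≡⟨ cong (_+ (δ u₂ v + δ u₃ v)) (chipsAt-update c i u₁ v) ⟩
  chipsAt c v + δ u₁ v + (δ u₂ v + δ u₃ v)
    ≡⟨ regroup₄ (chipsAt c v) (δ u₁ v) (δ u₂ v) (δ u₃ v) ⟩
  chipsAt c v + (δ u₁ v + δ u₂ v + δ u₃ v) ∎
  where
  open ≡-Reasoning
  c₁ = c [ i ]≔ u₁
  c₂ = c₁ [ j ]≔ u₂
  c₃ = c₂ [ k ]≔ u₃
  at₁j : lookup c₁ j ≡ x
  at₁j = trans (lookup∘update′ (i≢j ∘ sym) c u₁) atj
  at₂k : lookup c₂ k ≡ x
  at₂k = trans (lookup∘update′ (j≢k ∘ sym) c₁ u₂) (trans (lookup∘update′ (i≢k ∘ sym) c u₁) atk)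
  regroup₁ : ∀ a d → a + 3 * d ≡ a + d + d + d
  regroup₁ = solve-∀
  regroup₂ : ∀ a u d → a + u + d + d ≡ a + d + d + u
  regroup₂ = solve-∀
  regroup₃ : ∀ a u d w → a + u + d + w ≡ a + d + (u + w)
  regroup₃ = solve-∀
  regroup₄ : ∀ a u w z → a + u + (w + z) ≡ a + (u + w + z)
  regroup₄ = solve-∀

-- If `i` and `j` differed, moving `i` to a child of `v` would leave no chip at `v` by the count,
-- yet `j` would still be there.
chipsAt≤1⇒≡ : ∀ {N} (c : Config N) {v} → chipsAt c v ≤ 1 → ∀ {i j} → lookup c i ≡ v → lookup c j ≡ v → i ≡ j
chipsAt≤1⇒≡ c {v} ≤1 {i} {j} ati atj with i ≟F j
... | yes i≡j = i≡j
... | no i≢j  = contradiction (+-mono-≤ (chipsAt-lookup (c [ i ]≔ w) j atj′) (≤-refl {1})) (<⇒≱ (s≤s moved))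
  where
  w = false ∷ v
  atj′ : lookup (c [ i ]≔ w) j ≡ v
  atj′ = trans (lookup∘update′ (i≢j ∘ sym) c w) atj
  w≢v : w ≢ v
  w≢v ()
  moved : chipsAt (c [ i ]≔ w) v + 1 ≤ 1
  moved = begin
    chipsAt (c [ i ]≔ w) v + 1                ≡⟨ cong (chipsAt (c [ i ]≔ w) v +_) (trans (cong (λ u → δ u v) ati) (δ-refl v)) ⟨
    chipsAt (c [ i ]≔ w) v + δ (lookup c i) v ≡⟨ chipsAt-update c i w v ⟩
    chipsAt c v + δ w v                       ≡⟨ cong (chipsAt c v +_) (δ-≢ w≢v) ⟩
    chipsAt c v + 0                           ≡⟨ +-identityʳ _ ⟩
    chipsAt c v                               ≤⟨ ≤1 ⟩
    1                                         ∎
    where open ≤-Reasoning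

-- The order seen from a side: the chip sent to the child on side s is the s-most one.
_⟨_⟩_ : ∀ {N} → Fin N → Bool → Fin N → Set
i ⟨ false ⟩ j = toℕ i < toℕ j
i ⟨ true  ⟩ j = toℕ j < toℕ i

⟨⟩-trans : ∀ {N} s {i j k : Fin N} → i ⟨ s ⟩ j → j ⟨ s ⟩ k → i ⟨ s ⟩ k
⟨⟩-trans false i<j j<k = <-trans i<j j<k
⟨⟩-trans true  j<i k<j = <-trans k<j j<i

⟨⟩-irrefl : ∀ {N} s (i : Fin N) → ¬ i ⟨ s ⟩ i
⟨⟩-irrefl false i = <-irrefl refl
⟨⟩-irrefl true  i = <-irrefl refl

⟨⟩-total : ∀ {N} s (i j : Fin N) → i ⟨ s ⟩ j ⊎ i ≡ j ⊎ j ⟨ s ⟩ i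
⟨⟩-total s i j with <-cmp (toℕ i) (toℕ j)
⟨⟩-total false i j | tri< i<j _ _ = inj₁ i<j
⟨⟩-total true  i j | tri< i<j _ _ = inj₂ (inj₂ i<j)
⟨⟩-total s     i j | tri≈ _ eq _  = inj₂ (inj₁ (toℕ-injective eq))
⟨⟩-total false i j | tri> _ _ j<i = inj₂ (inj₂ j<i)
⟨⟩-total true  i j | tri> _ _ j<i = inj₁ j<i

⟨⟩-closed : ∀ {N} s {i j k : Fin N} → ¬ i ⟨ s ⟩ j → k ⟨ s ⟩ j → ¬ i ⟨ s ⟩ k
⟨⟩-closed s i≮j k<j i<k = i≮j (⟨⟩-trans s i<k k<j)

-- A fire seen symmetrically: with `s` for the near side and `not s` for the far side, later
-- arguments are made once for both sides.
record Firing {N} (c c′ : Config N) : Set where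
  field
    site     : Vertex
    child    : Bool → Fin N
    middle   : Fin N
    ordered  : ∀ s → child s ⟨ s ⟩ middle × middle ⟨ s ⟩ child (not s)
    child-at : ∀ s → lookup c (child s) ≡ site
    mid-at   : lookup c middle ≡ site
    child-to : ∀ s → lookup c′ (child s) ≡ s ∷ site
    mid-to   : lookup c′ middle ≡ parent site
    stays    : ∀ i → (∀ s → i ≢ child s) → i ≢ middle → lookup c′ i ≡ lookup c i
    balance  : ∀ v → chipsAt c′ v + 3 * δ site v ≡ chipsAt c v + (δ (false ∷ site) v + δ (parent site) v + δ (true ∷ site) v)
    exactly  : chipsAt c site ≡ 3 → ∀ i → lookup c i ≡ site → (∃ λ s → i ≡ child s) ⊎ i ≡ middle
    atLeast  : 3 ≤ chipsAt c site

  data Fate (i : Fin N) : Set where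
    toChild  : ∀ s → i ≡ child s → Fate i
    toParent : i ≡ middle → Fate i
    rests    : (∀ s → i ≢ child s) → i ≢ middle → Fate i

  fate : ∀ i → Fate i
  fate i with i ≟F child false | i ≟F child true | i ≟F middle
  ... | yes p | _     | _     = toChild false p
  ... | no _  | yes p | _     = toChild true p
  ... | no _  | no _  | yes p = toParent p
  ... | no p  | no q  | no r  = rests (λ { false → p ; true → q }) r

  unmoved : ∀ {i v} → lookup c i ≡ v → v ≢ site → lookup c′ i ≡ v
  unmoved {i} at v≢ with fate i
  ... | toChild s refl = contradiction (trans (sym at) (child-at s)) v≢
  ... | toParent refl  = contradiction (trans (sym at) mid-at) v≢
  ... | rests p q      = trans (stays i p q) at

firing : ∀ {N} {c c′ : Config N} → Fire c c′ → Firing c c′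
firing {N} {c} (x , i , j , k , i<j , j<k , ati , atj , atk , refl) = record
  { site = x ; child = child ; middle = j
  ; ordered  = λ { false → i<j , j<k ; true → j<k , i<j }
  ; child-at = λ { false → ati ; true → atk }
  ; mid-at   = atj
  ; child-to = λ { false → trans (lookup∘update′ i≢k c₂ _) (trans (lookup∘update′ i≢j c₁ _) (lookup∘update i c _))
                 ; true → lookup∘update k c₂ _ }
  ; mid-to   = trans (lookup∘update′ j≢k c₂ _) (lookup∘update j c₁ _)
  ; stays    = λ l l≢ l≢j → trans (lookup∘update′ (l≢ true) c₂ _) (trans (lookup∘update′ l≢j c₁ _) (lookup∘update′ (l≢ false) c _))
  ; balance  = chipsAt-update₃ c i≢j i≢k j≢k ati atj atk (leftChild x) (parent x) (rightChild x)
  ; exactly  = exactly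
  ; atLeast  = subst (3 ≤_) (trans away (+-identityʳ _)) (m≤n+m 3 (chipsAt elsewhere x))
  }
  where
  child : Bool → Fin N
  child false = i
  child true = k
  i≢j : i ≢ j
  i≢j refl = <-irrefl refl i<j
  j≢k : j ≢ k
  j≢k refl = <-irrefl refl j<k
  i≢k : i ≢ k
  i≢k refl = <-irrefl refl (<-trans i<j j<k)
  c₁ = c [ i ]≔ leftChild x
  c₂ = c₁ [ j ]≔ parent x
  u = leftChild x
  -- Not the fired configuration but one with all three chips moved off `x`: its count at `x` is
  -- what the fire leaves untouched, even at the root, which in reality keeps the middle chip.
  elsewhere = c [ i ]≔ u [ j ]≔ u [ k ]≔ u
  δu≡0 : δ u x ≡ 0
  δu≡0 = δ-≢ {u} {x} λ ()
  away : chipsAt elsewhere x + 3 ≡ chipsAt c x + 0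
  away = trans (cong (λ d → chipsAt elsewhere x + 3 * d) (sym (δ-refl x)))
    (trans (chipsAt-update₃ c i≢j i≢k j≢k ati atj atk u u u x) (cong (λ d → chipsAt c x + (d + d + d)) δu≡0))
  exactly : chipsAt c x ≡ 3 → ∀ l → lookup c l ≡ x → (∃ λ s → l ≡ child s) ⊎ l ≡ j
  exactly ≡3 l atl with l ≟F i | l ≟F k | l ≟F j
  ... | yes p | _     | _     = inj₁ (false , p)
  ... | no _  | yes p | _     = inj₁ (true , p)
  ... | no _  | no _  | yes p = inj₂ p
  ... | no p  | no q  | no r  = contradiction
    (chipsAt-lookup elsewhere l (trans (lookup∘update′ q (c [ i ]≔ u [ j ]≔ u) u) (trans (lookup∘update′ r (c [ i ]≔ u) u) (trans (lookup∘update′ p c u) atl))))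
    (<⇒≱ (s≤s (≤-reflexive (+-cancelʳ-≡ 3 _ 0 (trans away (trans (+-identityʳ _) ≡3))))))

-- `v` receives a chip from a fire of `x` exactly when `x` is its parent or one of its children;
-- with `parent [] = []` the self-loop obeys the same rule.
adjacency : ∀ x v → δ (false ∷ x) v + δ (parent x) v + δ (true ∷ x) v ≡ δ x (parent v) + (δ x (false ∷ v) + δ x (true ∷ v))
adjacency x v = trans (regroup (δ (false ∷ x) v) (δ (parent x) v) (δ (true ∷ x) v))
  (trans (cong (_+ δ (parent x) v) (children x v)) (trans (swapped x v)
    (cong (δ x (parent v) +_) (trans (sym (children v x)) (cong₂ _+_ (δ-sym (false ∷ v) x) (δ-sym (true ∷ v) x))))))
  where
  regroup : ∀ a b c → a + b + c ≡ (a + c) + b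
  regroup = solve-∀
  above : Vertex → Vertex → ℕ
  above x []      = 0
  above x (s ∷ v) = δ x v
  children : ∀ x v → δ (false ∷ x) v + δ (true ∷ x) v ≡ above x v
  children x [] = refl
  children x (false ∷ v) = trans (cong₂ _+_ (δ-∷ false x v) (δ-≢ {true ∷ x} {false ∷ v} λ ())) (+-identityʳ _)
  children x (true ∷ v) = cong₂ _+_ (δ-≢ {false ∷ x} {true ∷ v} λ ()) (δ-∷ true x v)
  swapped : ∀ x v → above x v + δ (parent x) v ≡ δ x (parent v) + above v x
  swapped [] [] = refl
  swapped [] (t ∷ v) = refl
  swapped (s ∷ x) [] = δ-sym x []
  swapped (s ∷ x) (t ∷ v) = cong (δ (s ∷ x) v +_) (δ-sym x (t ∷ v))

-- Remaining fires

open Firing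

full : ℕ → ℕ
full h = 2 ^ h ∸ 1

full-suc : ∀ h → full (suc h) ≡ suc (full h + full h)
full-suc h = trans (cong (λ x → 2 * x ∸ 1) (sym suc-full)) (eq (full h))
  where
  suc-full : suc (full h) ≡ 2 ^ h
  suc-full = m+[n∸m]≡n (m^n>0 2 h)
  eq : ∀ f → f + suc (f + 0) ≡ suc (f + f)
  eq = solve-∀

-- How often a vertex of height h fires altogether.
fires : ℕ → ℕ
fires zero    = 0
fires (suc h) = full (suc h) + fires h

fires-mono : ∀ {h k} → h ≤ k → fires h ≤ fires k
fires-mono z≤n = z≤n
fires-mono {suc h} {suc k} (s≤s h≤k) = +-mono-≤ (∸-monoˡ-≤ 1 (^-monoʳ-≤ 2 (s≤s h≤k))) (fires-mono h≤k)

-- This makes the hypothesis `r v < height v` of the invariants fail at the start.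
height≤fires : ∀ h → h ≤ fires h
height≤fires zero = z≤n
height≤fires (suc h) rewrite full-suc h = s≤s (≤-trans (height≤fires h) (m≤n+m _ _))

-- Needed for the balance of the initial configuration. At the root `full (suc h)` counts the chips
-- and `fires h` the loop; elsewhere there are no chips, and the two terms add up to the
-- `fires (suc h)` of the parent. The 1 is the chip that remains.
fires-balance : ∀ h → full (suc h) + (fires h + (fires (h ∸ 1) + fires (h ∸ 1))) ≡ 1 + 3 * fires h
fires-balance zero = refl
fires-balance (suc h) rewrite full-suc (suc h) = eq (full (suc h)) (fires h)
  where eq : ∀ f g → suc (f + f) + (f + g + (g + g)) ≡ 1 + 3 * (f + g)
        eq = solve-∀

-- The lower bounds add up to 3 + k + 2 (k - 1) = 1 + 3 k, so each of them is attained.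
tight : ∀ {n A B C k} → 3 ≤ n → k ≤ A → k ≤ suc B → k ≤ suc C → n + (A + (B + C)) ≡ 1 + 3 * k →
        n ≡ 3 × A ≡ k × suc B ≡ k × suc C ≡ k
tight {n} {A} {B} {C} {k} 3≤n k≤A k≤B k≤C eq
  with m≤n⇒∃[o]m+o≡n 3≤n | m≤n⇒∃[o]m+o≡n k≤A | m≤n⇒∃[o]m+o≡n k≤B | m≤n⇒∃[o]m+o≡n k≤C
... | n′ , refl | a , refl | b , eqB | c , eqC = zeros (+-cancelʳ-≡ (3 + 3 * k) (n′ + a + b + c) 0 (begin
  n′ + a + b + c + (3 + 3 * k)                  ≡⟨ regroup n′ a b c k ⟩
  3 + n′ + (k + a + ((k + b) + (k + c)))        ≡⟨ cong₂ (λ x y → 3 + n′ + (k + a + (x + y))) eqB eqC ⟩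
  3 + n′ + (k + a + (suc B + suc C))            ≡⟨ regroup′ (3 + n′) (k + a) B C ⟩
  2 + (3 + n′ + (k + a + (B + C)))              ≡⟨ cong (2 +_) eq ⟩
  3 + 3 * k                                     ∎))
  where
  open ≡-Reasoning
  regroup : ∀ n a b c k → n + a + b + c + (3 + 3 * k) ≡ 3 + n + (k + a + ((k + b) + (k + c)))
  regroup = solve-∀
  regroup′ : ∀ n a b c → n + (a + (suc b + suc c)) ≡ 2 + (n + (a + (b + c)))
  regroup′ = solve-∀
  zeros : n′ + a + b + c ≡ 0 → 3 + n′ ≡ 3 × k + a ≡ k × suc B ≡ k × suc C ≡ k
  zeros z with m+n≡0⇒m≡0 (n′ + a + b) z | m+n≡0⇒n≡0 (n′ + a + b) z
  ... | z′ | refl with m+n≡0⇒m≡0 (n′ + a) z′ | m+n≡0⇒n≡0 (n′ + a) z′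
  ... | z″ | refl with m+n≡0⇒m≡0 n′ z″ | m+n≡0⇒n≡0 n′ z″
  ... | refl | refl = refl , +-identityʳ k , trans (sym eqB) (+-identityʳ k) , trans (sym eqC) (+-identityʳ k)

fired : (Vertex → ℕ) → Vertex → Vertex → ℕ
fired r x v = r v ∸ δ x v

fired-site : ∀ r x → fired r x x ≡ pred (r x)
fired-site r x = trans (cong (r x ∸_) (δ-refl x)) (sym (pred[m∸n]≡m∸[1+n] (r x) 0))

fired-≢ : ∀ r {x v} → x ≢ v → fired r x v ≡ r v
fired-≢ r {x} {v} x≢v = cong (r v ∸_) (δ-≢ x≢v)

fired-≤ : ∀ r x v → fired r x v ≤ r v
fired-≤ r x v = m∸n≤m (r v) (δ x v)

fired-+δ : ∀ r x v → 1 ≤ r x → fired r x v + δ x v ≡ r v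
fired-+δ r x v 1≤ = m∸n+n≡m (δ≤ (x ≟V v))
  where
  δ≤ : Dec (x ≡ v) → δ x v ≤ r v
  δ≤ (yes refl) = subst (_≤ r x) (sym (δ-refl x)) 1≤
  δ≤ (no x≢v)   = subst (_≤ r v) (sym (δ-≢ x≢v)) z≤n

pred<⇒≤ : ∀ {k n} → 1 ≤ k → pred k < n → k ≤ n
pred<⇒≤ {suc k} _ k<n = k<n

≢-child : ∀ {s} {v : Vertex} → s ∷ v ≢ v
≢-child ()

≢-grandchild : ∀ {s t} {v : Vertex} → s ∷ t ∷ v ≢ v
≢-grandchild ()

module _ (m : ℕ) where

  height : Vertex → ℕ
  height v = m ∸ suc (length v)

  height-∷ : ∀ s v → height (s ∷ v) ≡ pred (height v)
  height-∷ s v = sym (pred[m∸n]≡m∸[1+n] m (suc (length v)))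

  <height-∷ : ∀ {s v k} → k < height (s ∷ v) → suc k < height v
  <height-∷ {s} {v} {k} k< = go (height v) (subst (k <_) (height-∷ s v) k<)
    where
    go : ∀ h → k < pred h → suc k < h
    go (suc h) k<h = s≤s k<h

  -- r v is the number of fires of v still to come.  Near the end (r v ≤ height v) parent and child fire alternately.
  record Balanced {N} (c : Config N) (r : Vertex → ℕ) : Set where
    field
      balanced : ∀ v → length v < m → chipsAt c v + (r (parent v) + (r (false ∷ v) + r (true ∷ v))) ≡ 1 + 3 * r v
      deep     : ∀ v → m ≤ suc (length v) → r v ≡ 0
      outside  : ∀ v → m ≤ length v → chipsAt c v ≡ 0
      behind   : ∀ s v → r v ≤ height (s ∷ v) → r (s ∷ v) ≤ r v
      ahead    : ∀ s v → r (s ∷ v) < height (s ∷ v) → r v ≤ suc (r (s ∷ v))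
      bounded  : ∀ v → r v ≤ fires m

  module Step {N} {c c′ : Config N} {r} (B : Balanced c r) (f : Firing c c′) where
    open Balanced B
    x = site f

    inside : length x < m
    inside = ≰⇒> λ m≤ → contradiction (subst (3 ≤_) (outside x m≤) (atLeast f)) λ ()

    -- Three chips at `x` make 1 + 3 r x at least 3. So a vertex without remaining fires cannot
    -- fire, and the subtraction in `fired` does not truncate.
    pending : 1 ≤ r x
    pending = ≢0⇒1≤ λ r≡0 → contradiction
      (≤-trans (atLeast f) (≤-trans (m≤m+n _ _) (≤-reflexive (trans (balanced x inside) (cong (λ k → 1 + 3 * k) r≡0))))) λ { (s≤s ()) }
      where
      ≢0⇒1≤ : ∀ {k} → k ≢ 0 → 1 ≤ k
      ≢0⇒1≤ {zero} k≢0 = contradiction refl k≢0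
      ≢0⇒1≤ {suc k} _ = s≤s z≤n

    r′ = fired r x

    not-site : ∀ {v} → r v ≡ 0 → v ≢ x
    not-site r≡0 refl = contradiction (subst (1 ≤_) r≡0 pending) λ ()

    internal : suc (length x) < m
    internal = ≰⇒> λ m≤ → contradiction (subst (1 ≤_) (deep x m≤) pending) λ ()

    height-site : suc (pred (height x)) ≡ height x
    height-site = go (height x) (m<n⇒0<n∸m internal)
      where
      go : ∀ h → 0 < h → suc (pred h) ≡ h
      go (suc h) _ = refl

    -- Near the end `behind` leaves the parent at least `r x` fires, and `ahead` leaves each child
    -- at least one fewer than `r x`; the balance at `x` then has no slack.
    sync : r x ≤ height x → chipsAt c x ≡ 3 × r (parent x) ≡ r x × (∀ s → suc (r (s ∷ x)) ≡ r x)
    sync r≤h with tight (atLeast f) (parent≥ x refl r≤h) (child≥ false) (child≥ true) (balanced x inside)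
      where
      parent≥ : ∀ y → y ≡ x → r y ≤ height y → r y ≤ r (parent y)
      parent≥ [] _ _ = ≤-refl
      parent≥ (s ∷ p) _ le = ≮⇒≥ λ p< → <⇒≱ p< (behind s p (≤-trans (<⇒≤ p<) le))
      child≥ : ∀ s → r x ≤ suc (r (s ∷ x))
      child≥ s = ≮⇒≥ λ s< → <⇒≱ s< (ahead s x (subst (r (s ∷ x) <_) (sym (height-∷ s x))
        (s≤s⁻¹ (subst (suc (r (s ∷ x)) <_) (sym height-site) (≤-trans s< r≤h)))))
    ... | n≡3 , p≡ , l≡ , r≡ = n≡3 , p≡ , λ { false → l≡ ; true → r≡ }

    step : Balanced c′ r′
    step = record
      { balanced = balanced′
      ; deep     = λ v m≤ → n≤0⇒n≡0 (≤-trans (fired-≤ r x v) (≤-reflexive (deep v m≤)))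
      ; outside  = outside′
      ; behind   = λ s v → behind′ s v (x ≟V v)
      ; ahead    = λ s v → ahead′ s v (x ≟V (s ∷ v))
      ; bounded  = λ v → ≤-trans (fired-≤ r x v) (bounded v)
      }
      where
      balanced′ : ∀ v → length v < m → chipsAt c′ v + (r′ (parent v) + (r′ (false ∷ v) + r′ (true ∷ v))) ≡ 1 + 3 * r′ v
      balanced′ v v<m = +-cancelʳ-≡ (3 * δ x v) _ _ (begin
        chipsAt c′ v + (r′ (parent v) + (r′ (false ∷ v) + r′ (true ∷ v))) + 3 * δ x v
          ≡⟨ regroup (chipsAt c′ v) (r′ (parent v)) (r′ (false ∷ v)) (r′ (true ∷ v)) (3 * δ x v) ⟩
        (chipsAt c′ v + 3 * δ x v) + (r′ (parent v) + (r′ (false ∷ v) + r′ (true ∷ v)))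
          ≡⟨ cong (_+ (r′ (parent v) + (r′ (false ∷ v) + r′ (true ∷ v)))) (trans (balance f v) (cong (chipsAt c v +_) (adjacency x v))) ⟩
        chipsAt c v + (δ x (parent v) + (δ x (false ∷ v) + δ x (true ∷ v))) + (r′ (parent v) + (r′ (false ∷ v) + r′ (true ∷ v)))
          ≡⟨ regroup′ (chipsAt c v) (δ x (parent v)) (δ x (false ∷ v)) (δ x (true ∷ v)) (r′ (parent v)) (r′ (false ∷ v)) (r′ (true ∷ v)) ⟩
        chipsAt c v + ((r′ (parent v) + δ x (parent v)) + ((r′ (false ∷ v) + δ x (false ∷ v)) + (r′ (true ∷ v) + δ x (true ∷ v))))
          ≡⟨ cong₂ (λ a b → chipsAt c v + (a + b)) (fired-+δ r x (parent v) pending)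
               (cong₂ _+_ (fired-+δ r x (false ∷ v) pending) (fired-+δ r x (true ∷ v) pending)) ⟩
        chipsAt c v + (r (parent v) + (r (false ∷ v) + r (true ∷ v)))
          ≡⟨ balanced v v<m ⟩
        1 + 3 * r v
          ≡⟨ cong (λ k → 1 + 3 * k) (fired-+δ r x v pending) ⟨
        1 + 3 * (r′ v + δ x v)
          ≡⟨ cong (1 +_) (*-distribˡ-+ 3 (r′ v) (δ x v)) ⟩
        1 + 3 * r′ v + 3 * δ x v ∎)
        where
        open ≡-Reasoning
        regroup : ∀ a b c d e → a + (b + (c + d)) + e ≡ (a + e) + (b + (c + d))
        regroup = solve-∀
        regroup′ : ∀ a b c d e f g → a + (b + (c + d)) + (e + (f + g)) ≡ a + ((e + b) + ((f + c) + (g + d)))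
        regroup′ = solve-∀
      outside′ : ∀ v → m ≤ length v → chipsAt c′ v ≡ 0
      outside′ v m≤ = m+n≡0⇒m≡0 (chipsAt c′ v) (trans (balance f v) (cong₂ _+_ (outside v m≤)
        (cong₂ _+_ (cong₂ _+_ (δ-≢ {false ∷ x} (shorter internal)) (δ-≢ {parent x} (shorter (parent< x inside)))) (δ-≢ {true ∷ x} (shorter internal)))))
        where
        shorter : ∀ {w} → length w < m → w ≢ v
        shorter w<m refl = <⇒≱ w<m m≤
        parent< : ∀ y → length y < m → length (parent y) < m
        parent< [] lt = lt
        parent< (_ ∷ y) lt = <-trans ≤-refl lt
      -- Only a fire of `v` could break this, and then `sync` says that the child already had one
      -- fire fewer left.
      behind′ : ∀ s v → Dec (x ≡ v) → r′ v ≤ height (s ∷ v) → r′ (s ∷ v) ≤ r′ v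
      behind′ s v (yes refl) le = begin
        r′ (s ∷ x)   ≡⟨ fired-≢ r (≢-child ∘ sym) ⟩
        r (s ∷ x)    ≡⟨ cong pred (proj₂ (proj₂ (sync (pred<⇒≤ pending (subst₂ _<_ (fired-site r x) (trans (cong suc (height-∷ s x)) height-site) (s≤s le))))) s) ⟩
        pred (r x)   ≡⟨ fired-site r x ⟨
        r′ x         ∎
        where open ≤-Reasoning
      behind′ s v (no x≢v) le = ≤-trans (fired-≤ r x (s ∷ v)) (subst (r (s ∷ v) ≤_) (sym (fired-≢ r x≢v))
        (behind s v (subst (_≤ height (s ∷ v)) (fired-≢ r x≢v) le)))
      -- Only a fire of the child could break this, and then `sync` says that parent and child were
      -- level.
      ahead′ : ∀ s v → Dec (x ≡ s ∷ v) → r′ (s ∷ v) < height (s ∷ v) → r′ v ≤ suc (r′ (s ∷ v))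
      ahead′ s v (yes x≡) lt = begin
        r′ v                ≤⟨ fired-≤ r x v ⟩
        r v                 ≡⟨ cong (r ∘ parent) x≡ ⟨
        r (parent x)        ≡⟨ proj₁ (proj₂ (sync (pred<⇒≤ pending (subst₂ _<_ (fired-site r x) refl (subst (λ u → r′ u < height u) (sym x≡) lt))))) ⟩
        r x                 ≡⟨ suc-pred (r x) {{>-nonZero pending}} ⟨
        suc (pred (r x))    ≡⟨ cong suc (fired-site r x) ⟨
        suc (r′ x)          ≡⟨ cong (λ u → suc (r′ u)) x≡ ⟩
        suc (r′ (s ∷ v))    ∎
        where open ≤-Reasoning
      ahead′ s v (no x≢) lt = ≤-trans (fired-≤ r x v) (subst (λ k → r v ≤ suc k) (sym (fired-≢ r x≢))
        (ahead s v (subst (_< height (s ∷ v)) (fired-≢ r x≢) lt)))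

  chipsAt-initial : ∀ N v → chipsAt (initial N) v ≡ N * δ [] v
  chipsAt-initial zero v = refl
  chipsAt-initial (suc N) v = trans (chipsAt-∷ [] (initial N) v) (cong (δ [] v +_) (chipsAt-initial N v))

  initially : Vertex → ℕ
  initially v = fires (height v)

  balanced-initially : Balanced (initial (2 ^ m ∸ 1)) initially
  balanced-initially = record
    { balanced = bal
    ; deep     = λ v m≤ → cong fires (m≤n⇒m∸n≡0 m≤)
    ; outside  = out
    ; behind   = λ s v _ → fires-mono (∸-monoʳ-≤ m (n≤1+n (suc (length v))))
    ; ahead    = λ s v lt → contradiction (height≤fires (height (s ∷ v))) (<⇒≱ lt)
    ; bounded  = λ v → fires-mono (m∸n≤m m (suc (length v)))
    }
    where
    out : ∀ v → m ≤ length v → chipsAt (initial (2 ^ m ∸ 1)) v ≡ 0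
    out [] z≤n = refl
    out (s ∷ v) _ = trans (chipsAt-initial (2 ^ m ∸ 1) (s ∷ v)) (*-zeroʳ (2 ^ m ∸ 1))
    height≡ : ∀ k e → m ≡ suc k + e → m ∸ suc k ≡ e
    height≡ k e refl = m+n∸m≡n k e
    bal : ∀ v → length v < m → chipsAt (initial (2 ^ m ∸ 1)) v + (initially (parent v) + (initially (false ∷ v) + initially (true ∷ v))) ≡ 1 + 3 * initially v
    bal [] 0<m = trans (cong (_+ (fires (m ∸ 1) + (fires (m ∸ 2) + fires (m ∸ 2)))) (trans (chipsAt-initial (2 ^ m ∸ 1) []) (*-identityʳ (2 ^ m ∸ 1)))) (go m 0<m)
      where
      go : ∀ m → 0 < m → full m + (fires (m ∸ 1) + (fires (m ∸ 2) + fires (m ∸ 2))) ≡ 1 + 3 * fires (m ∸ 1)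
      go (suc h) _ = fires-balance h
    bal (s ∷ v) lt with m≤n⇒∃[o]m+o≡n lt
    ... | e , eq = begin
      chipsAt (initial (2 ^ m ∸ 1)) (s ∷ v) + (fires (height v) + (fires (m ∸ (3 + length v)) + fires (m ∸ (3 + length v))))
        ≡⟨ cong₂ _+_ (trans (chipsAt-initial (2 ^ m ∸ 1) (s ∷ v)) (*-zeroʳ (2 ^ m ∸ 1)))
             (cong₂ (λ a b → fires a + (fires b + fires b)) (height≡ (length v) (suc e) (trans (sym eq) (cong suc (sym (+-suc (length v) e)))))
               (trans (sym (pred[m∸n]≡m∸[1+n] m (2 + length v))) (trans (cong pred height-v) (pred[m∸n]≡m∸[1+n] e 0)))) ⟩
      full (suc e) + fires e + (fires (e ∸ 1) + fires (e ∸ 1))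
        ≡⟨ +-assoc (full (suc e)) (fires e) _ ⟩
      full (suc e) + (fires e + (fires (e ∸ 1) + fires (e ∸ 1)))
        ≡⟨ fires-balance e ⟩
      1 + 3 * fires e
        ≡⟨ cong (λ k → 1 + 3 * fires k) height-v ⟨
      1 + 3 * fires (height (s ∷ v)) ∎
      where
      open ≡-Reasoning
      height-v : m ∸ (2 + length v) ≡ e
      height-v = height≡ (suc (length v)) e (sym eq)

  -- In a stable configuration the maximum of r over a layer is at most that over the next layer; it vanishes on the last one.
  module _ {N} {c : Config N} {r} (B : Balanced c r) (stable : IsStable c) where
    open Balanced B

    private
      layer-≤ : ∀ k b → k < m → (∀ v → length v ≡ suc k → r v ≤ b) → ∀ v → length v ≡ k → r v ≤ b
      -- Lowers the bound by one unit at a time. If r v exceeds b + n, the balance needs at least 1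
      -- + 3 (b + n + 1); but there are at most 2 chips, the parent contributes at most b + n + 1
      -- (by `layer-≤` one layer up) and each child at most b.
      descend : ∀ k b n → k < m → (∀ v → length v ≡ suc k → r v ≤ b) → (∀ v → length v ≡ k → r v ≤ b + n) → ∀ v → length v ≡ k → r v ≤ b

      layer-≤ k b k<m next = descend k b (fires m) k<m next (λ v _ → ≤-trans (bounded v) (m≤n+m _ b))

      descend k b zero k<m next le v len = subst (r v ≤_) (+-identityʳ b) (le v len)
      descend k b (suc n) k<m next le = descend k b n k<m next lower
        where
        parent-≤ : ∀ k → k < m → (∀ v → length v ≡ k → r v ≤ b + suc n) → ∀ v → length v ≡ k → r (parent v) ≤ b + suc n
        parent-≤ zero _ le [] len = le [] len
        parent-≤ (suc k) k<m le (s ∷ v) len = layer-≤ k (b + suc n) (<-trans ≤-refl k<m) le v (suc-injective len)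
        lower : ∀ v → length v ≡ k → r v ≤ b + n
        lower v len = ≮⇒≥ λ lt → <⇒≱ (begin-strict
          1 + 3 * r v
            ≡⟨ balanced v (subst (_< m) (sym len) k<m) ⟨
          chipsAt c v + (r (parent v) + (r (false ∷ v) + r (true ∷ v)))
            ≤⟨ +-mono-≤ (s≤s⁻¹ (stable v)) (+-mono-≤ (parent-≤ k k<m le v len) (+-mono-≤ (next (false ∷ v) (cong suc len)) (next (true ∷ v) (cong suc len)))) ⟩
          2 + (b + suc n + (b + b))
            <⟨ m<m+n _ {suc (n + n)} (s≤s z≤n) ⟩
          2 + (b + suc n + (b + b)) + suc (n + n)
            ≡⟨ eq b n ⟩
          1 + 3 * suc (b + n) ∎) (s≤s (*-monoʳ-≤ 3 lt))
          where
          open ≤-Reasoning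
          eq : ∀ b n → 2 + (b + suc n + (b + b)) + suc (n + n) ≡ 1 + 3 * suc (b + n)
          eq = solve-∀

      layer-0 : ∀ d k → k + d ≡ m → ∀ v → length v ≡ k → r v ≡ 0
      layer-0 zero k k≡m v len = deep v (subst (_≤ suc (length v)) (trans len (trans (sym (+-identityʳ k)) k≡m)) (n≤1+n _))
      layer-0 (suc d) k eq v len = n≤0⇒n≡0 (layer-≤ k 0 (subst (k <_) eq (m<m+n k (s≤s z≤n)))
        (λ w len′ → ≤-reflexive (layer-0 d (suc k) (trans (sym (+-suc k d)) eq) w len′)) v len)

    finished : ∀ v → r v ≡ 0
    finished v with m ≤? length v
    ... | yes m≤ = deep v (m≤n⇒m≤1+n m≤)
    ... | no m≰ = layer-0 (m ∸ length v) (length v) (m+[n∸m]≡n (<⇒≤ (≰⇒> m≰))) v refl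

    one-chip : ∀ v → length v < m → chipsAt c v ≡ 1
    one-chip v v<m = begin
      chipsAt c v                                                          ≡⟨ +-identityʳ _ ⟨
      chipsAt c v + 0                                                      ≡⟨ cong (chipsAt c v +_) (cong₂ _+_ (finished (parent v)) (cong₂ _+_ (finished (false ∷ v)) (finished (true ∷ v)))) ⟨
      chipsAt c v + (r (parent v) + (r (false ∷ v) + r (true ∷ v)))        ≡⟨ balanced v v<m ⟩
      1 + 3 * r v                                                          ≡⟨ cong (λ k → 1 + 3 * k) (finished v) ⟩
      1                                                                    ∎
      where open ≡-Reasoning

  run : (I : Config (2 ^ m ∸ 1) → (Vertex → ℕ) → Set) → I (initial _) initially →
        (∀ {c c′ r} → Balanced c r → (f : Firing c c′) → I c r → I c′ (fired r (site f))) →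
        ∀ {c} → Reachable c → ∃ λ r → Balanced c r × I c r
  run I start next = go balanced-initially start
    where
    go : ∀ {c d r} → Balanced c r → I c r → Star Fire c d → ∃ λ r → Balanced d r × I d r
    go B i ε = _ , B , i
    go B i (f ◅ fs) = go (Step.step B (firing f)) (next B (firing f) i) fs

-- Positions of extreme chips

Below : Vertex → Vertex → Set
Below w u = ∃ λ t → u ≡ t ++ w

below-refl : ∀ {w} → Below w w
below-refl = [] , refl

below-∷ : ∀ {w u} s → Below w u → Below w (s ∷ u)
below-∷ s (t , refl) = s ∷ t , refl

below-parent : ∀ {w} u → Below w (parent u) → Below w u
below-parent [] b = b
below-parent (s ∷ u) b = below-∷ s b

below-∷⁻ : ∀ {d v s u} → Below (d ∷ v) (s ∷ u) → (s ≡ d × u ≡ v) ⊎ Below (d ∷ v) u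
below-∷⁻ ([] , refl) = inj₁ (refl , refl)
below-∷⁻ (_ ∷ t , eq) = inj₂ (t , ∷-injectiveʳ eq)

below-split : ∀ {v u} → Below v u → u ≡ v ⊎ ∃ λ s → Below (s ∷ v) u
below-split {v} (t , refl) with initLast t
... | [] = inj₁ refl
... | t′ ∷ʳ′ s = inj₂ (s , t′ , ++-assoc t′ (s ∷ []) v)

below-length : ∀ {w u} → Below w u → length w ≤ length u
below-length ([] , refl) = ≤-refl
below-length (s ∷ t , refl) = m≤n⇒m≤1+n (below-length (t , refl))

¬below-parent : ∀ {s v} → ¬ Below (s ∷ v) v
¬below-parent b = <⇒≱ ≤-refl (below-length b)

-- Fix a set Z of chips closed towards side s.  Every fire that moves a chip of Z sends one to the s-child,
-- so the s-subtree of a vertex, once entered by Z, never becomes free of Z again.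
module Sweep (m : ℕ) {N : ℕ} (s : Bool) (Z : Fin N → Set) (closed : ∀ {i j} → Z i → j ⟨ s ⟩ i → Z j) where

  Free : Config N → Vertex → Set
  Free c w = ∀ i → Z i → ¬ Below w (lookup c i)

  -- `relay` guards the far child p of q. After p has fired, and until q does, q holds a chip
  -- outside `Z` that came up from p. The next fire of q uses exactly three chips, so its far chip,
  -- which is that one or lies beyond it, is outside `Z` too, and p stays clean.
  record Swept (c : Config N) (r : Vertex → ℕ) : Set where
    field
      sides : ∀ v → Free c (s ∷ v) → Free c (not s ∷ v)
      clean : ∀ v → r v < height m v → Free c (s ∷ v) → ∀ i → Z i → lookup c i ≢ v
      relay : ∀ q → r (not s ∷ q) < height m (not s ∷ q) → Free c (s ∷ not s ∷ q) → r q ≡ suc (r (not s ∷ q)) →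
              ∃ λ j → lookup c j ≡ q × ¬ Z j

    free : ∀ v → r v < height m v → Free c (s ∷ v) → Free c v
    free v lt fr i Zi b with below-split b
    ... | inj₁ at = clean v lt fr i Zi at
    ... | inj₂ (d , b′) with d ≟B s
    ... | yes refl = fr i Zi b′
    ... | no d≢s = sides v fr i Zi (subst (λ d → Below (d ∷ v) _) (¬-not d≢s) b′)

  module _ {c c′ : Config N} {r} (B : Balanced m c r) (f : Firing c c′) (S : Swept c r) where
    open Balanced B
    open Step m B f using (x; pending; sync; r′)
    open Swept S

    private
      middle⇒near : Z (middle f) → Z (child f s)
      middle⇒near Zm = closed Zm (proj₁ (ordered f s))

      far⇒middle : Z (child f (not s)) → Z (middle f)
      far⇒middle Zf = closed Zf (proj₂ (ordered f s))

      child⇒near : ∀ d → Z (child f d) → Z (child f s)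
      child⇒near d Zd with d ≟B s
      ... | yes refl = Zd
      ... | no d≢s = middle⇒near (far⇒middle (subst (Z ∘ child f) (¬-not d≢s) Zd))

      near-free : ∀ {w} → Free c′ w → Z (child f s) → ¬ Below w x
      near-free fr Zn b = fr (child f s) Zn (subst (Below _) (sym (child-to f s)) (below-∷ s b))

      free-before : ∀ {w} → Free c′ w → Free c w
      free-before fr i Zi b with fate f i
      ... | toChild d refl = near-free fr (child⇒near d Zi) (subst (Below _) (child-at f d) b)
      ... | toParent refl  = near-free fr (middle⇒near Zi) (subst (Below _) (mid-at f) b)
      ... | rests p q      = fr i Zi (subst (Below _) (sym (stays f i p q)) b)

      near-∉ : ∀ {v} → Free c′ (s ∷ v) → v ≡ x → ¬ Z (child f s)
      near-∉ fr refl Zn = fr (child f s) Zn (subst (Below _) (sym (child-to f s)) below-refl)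

      sides′ : ∀ v → Free c′ (s ∷ v) → Free c′ (not s ∷ v)
      sides′ v fr i Zi b with fate f i
      ... | toParent refl = sides v (free-before fr) i Zi (subst (Below _) (sym (mid-at f)) (below-parent x (subst (Below _) (mid-to f) b)))
      ... | rests p q = sides v (free-before fr) i Zi (subst (Below _) (stays f i p q) b)
      ... | toChild d refl with below-∷⁻ (subst (Below _) (child-to f d) b)
      ... | inj₁ (refl , x≡v) = near-∉ fr (sym x≡v) (child⇒near d Zi)
      ... | inj₂ b′ = sides v (free-before fr) i Zi (subst (Below _) (sym (child-at f d)) b′)

      late : ∀ {v} → x ≡ v → r′ v < height m v → r x ≤ height m x
      late refl lt = pred<⇒≤ pending (subst (_< height m x) (fired-site r x) lt)

      same : ∀ {v} → x ≢ v → r′ v < height m v → r v < height m v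
      same x≢v lt = subst (_< _) (fired-≢ r x≢v) lt

      clean′ : ∀ v → Dec (x ≡ v) → r′ v < height m v → Free c′ (s ∷ v) → ∀ i → Z i → lookup c′ i ≢ v
      -- A late fire uses exactly the chips present, so only the middle chip of the root can remain,
      -- and it is outside `Z` because the near chip is.
      clean′ v (yes x≡v) lt fr i Zi at with fate f i
      ... | toChild d refl = ≢-child (trans (sym (child-to f d)) (trans at (sym x≡v)))
      ... | toParent refl = near-∉ fr (sym x≡v) (middle⇒near Zi)
      ... | rests p q with exactly f (proj₁ (sync (late x≡v lt))) i (trans (sym (stays f i p q)) (trans at (sym x≡v)))
      ... | inj₁ (d , i≡) = p d i≡
      ... | inj₂ i≡ = q i≡
      clean′ v (no x≢v) lt fr i Zi at with fate f i
      ... | rests p q = clean v (same x≢v lt) (free-before fr) i Zi (trans (sym (stays f i p q)) at)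
      ... | toParent refl = from-child x refl (trans (sym (mid-to f)) at)
        where
        from-child : ∀ y → y ≡ x → parent y ≡ v → ⊥
        from-child [] []≡x []≡v = x≢v (trans (sym []≡x) []≡v)
        from-child (d ∷ _) d≡x refl with d ≟B s
        ... | yes refl = free-before fr i Zi (subst (Below _) (trans d≡x (sym (mid-at f))) below-refl)
        ... | no d≢s = sides v (free-before fr) i Zi (subst (Below _) (trans d≡x (sym (mid-at f))) (subst (λ d → Below (not s ∷ v) (d ∷ v)) (sym (¬-not d≢s)) below-refl))
      ... | toChild d refl with trans (sym (child-to f d)) at
      ... | refl with d ≟B s
      -- Here `v` is the `s`-child of `x` and its whole subtree was free of `Z`; hence `x` itself
      -- was clean and had nothing of `Z` to send down.
      ... | yes refl = clean x (≤-<-trans (ahead s x lt′) (<height-∷ m {s} {x} lt′)) (free v lt′ (free-before fr)) i Zi (child-at f d)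
        where lt′ = same x≢v lt
      ... | no d≢s with refl ← ¬-not d≢s with relay x lt′ (free-before fr) (sym (proj₂ (proj₂ (sync r≤h)) (not s)))
        where
        lt′ = same x≢v lt
        r≤h = ≤-trans (ahead (not s) x lt′) (<⇒≤ (<height-∷ m {not s} {x} lt′))
      ... | j , j-at , ¬Zj with exactly f (proj₁ (sync (≤-trans (ahead (not s) x (same x≢v lt)) (<⇒≤ (<height-∷ m {not s} {x} (same x≢v lt)))))) j j-at
      ... | inj₂ refl = ¬Zj (far⇒middle Zi)
      ... | inj₁ (e , refl) with e ≟B s
      ... | yes refl = ¬Zj (child⇒near (not s) Zi)
      ... | no e≢s with refl ← ¬-not e≢s = ¬Zj Zi

      relay′ : ∀ q → Dec (x ≡ not s ∷ q) → Dec (x ≡ q) → r′ (not s ∷ q) < height m (not s ∷ q) → Free c′ (s ∷ not s ∷ q) →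
               r′ q ≡ suc (r′ (not s ∷ q)) → ∃ λ j → lookup c′ j ≡ q × ¬ Z j
      relay′ q (yes x≡) _ lt fr eq = middle f , trans (mid-to f) (cong parent x≡) , near-∉ fr (sym x≡) ∘ middle⇒near
      -- Before this fire q would have had two more fires left than its far child, against `ahead`.
      relay′ q (no x≢p) (yes refl) lt fr eq = contradiction (ahead (not s) x (same x≢p lt))
        (<⇒≱ (≤-reflexive (trans (cong suc (trans (cong suc (sym (fired-≢ r x≢p))) (trans (sym eq) (fired-site r x)))) (suc-pred (r x) {{>-nonZero pending}}))))
      relay′ q (no x≢p) (no x≢q) lt fr eq with relay q (same x≢p lt) (free-before fr)
        (trans (sym (fired-≢ r x≢q)) (trans eq (cong suc (fired-≢ r x≢p))))
      ... | j , j-at , ¬Zj = j , unmoved f j-at (x≢q ∘ sym) , ¬Zj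

    swept-step : Swept c′ (fired r (site f))
    swept-step = record
      { sides = sides′
      ; clean = λ v → clean′ v (x ≟V v)
      ; relay = λ q → relay′ q (x ≟V (not s ∷ q)) (x ≟V q)
      }

module Nesting (m : ℕ) {N : ℕ} (s : Bool) where

  -- The chips of the last fire of s ∷ p: the middle one joins the last fire of p, whose s-most chip then settles at s ∷ p.
  record Nested (c : Config N) (r : Vertex → ℕ) : Set where
    field
      passed  : ∀ p → 1 ≤ height m (s ∷ p) → r (s ∷ p) ≡ 0 → r p ≡ 1 →
                ∃₂ λ i j → lookup c i ≡ not s ∷ s ∷ p × lookup c j ≡ p × j ⟨ s ⟩ i
      settled : ∀ p → 1 ≤ height m (s ∷ p) → r p ≡ 0 →
                ∃₂ λ i j → lookup c i ≡ not s ∷ s ∷ p × lookup c j ≡ s ∷ p × j ⟨ s ⟩ i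

  module _ {c c′ : Config N} {r} (B : Balanced m c r) (f : Firing c c′) (E : Nested c r) where
    open Balanced B
    open Step m B f using (x; pending; sync; r′; not-site)
    open Nested E

    private
      child-0 : ∀ d v → r v ≡ 0 → r (d ∷ v) ≡ 0
      child-0 d v r≡0 = n≤0⇒n≡0 (subst (r (d ∷ v) ≤_) r≡0 (behind d v (subst (_≤ _) (sym r≡0) z≤n)))

      before : ∀ {v k} → x ≡ v → r′ v ≡ k → r v ≡ suc k
      before refl eq = trans (sym (suc-pred (r x) {{>-nonZero pending}})) (cong suc (trans (sym (fired-site r x)) eq))

      passed′ : ∀ p → Dec (x ≡ s ∷ p) → Dec (x ≡ p) → 1 ≤ height m (s ∷ p) → r′ (s ∷ p) ≡ 0 → r′ p ≡ 1 →
                ∃₂ λ i j → lookup c′ i ≡ not s ∷ s ∷ p × lookup c′ j ≡ p × j ⟨ s ⟩ i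
      passed′ p (yes x≡) _ h u≡0 p≡1 = child f (not s) , middle f ,
        trans (child-to f (not s)) (cong (not s ∷_) x≡) , trans (mid-to f) (cong parent x≡) , proj₂ (ordered f s)
      passed′ p (no x≢u) (yes x≡p) h u≡0 p≡1 = contradiction
        (ahead s p (subst (_< height m (s ∷ p)) (sym r≡0) h)) (<⇒≱ (subst₂ _<_ (cong suc (sym r≡0)) (sym (before x≡p p≡1)) ≤-refl))
        where r≡0 = trans (sym (fired-≢ r x≢u)) u≡0
      passed′ p (no x≢u) (no x≢p) h u≡0 p≡1 with passed p h r≡0 (trans (sym (fired-≢ r x≢p)) p≡1)
        where r≡0 = trans (sym (fired-≢ r x≢u)) u≡0
      ... | i , j , i-at , j-at , j⟨⟩i = i , j , unmoved f i-at (not-site (child-0 (not s) (s ∷ p) (trans (sym (fired-≢ r x≢u)) u≡0))) , unmoved f j-at (x≢p ∘ sym) , j⟨⟩i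

      settled′ : ∀ p → Dec (x ≡ p) → 1 ≤ height m (s ∷ p) → r′ p ≡ 0 →
                 ∃₂ λ i j → lookup c′ i ≡ not s ∷ s ∷ p × lookup c′ j ≡ s ∷ p × j ⟨ s ⟩ i
      settled′ p (no x≢p) h p≡0 with settled p h (trans (sym (fired-≢ r x≢p)) p≡0)
      ... | i , j , i-at , j-at , j⟨⟩i = i , j , unmoved f i-at (not-site (child-0 (not s) (s ∷ p) r≡0)) , unmoved f j-at (not-site r≡0) , j⟨⟩i
        where r≡0 = child-0 s p (trans (sym (fired-≢ r x≢p)) p≡0)
      settled′ .x (yes refl) h p≡0 with passed x h (suc-injective (trans (proj₂ (proj₂ synced) s) (before refl p≡0))) (before refl p≡0)
        where synced = sync (subst (_≤ height m x) (sym (before refl p≡0)) (≤-trans (n≤1+n 1) (<height-∷ m {s} {x} h)))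
      ... | i , j , i-at , j-at , j⟨⟩i = i , child f s , unmoved f i-at ≢-grandchild , child-to f s , nearer
        where
        synced = sync (subst (_≤ height m x) (sym (before refl p≡0)) (≤-trans (n≤1+n 1) (<height-∷ m {s} {x} h)))
        -- The fire uses all chips at `x`, among them `j`; so the near chip is `j` or lies further
        -- towards `s`.
        nearer : child f s ⟨ s ⟩ i
        nearer with exactly f (proj₁ synced) j j-at
        ... | inj₂ refl = ⟨⟩-trans s (proj₁ (ordered f s)) j⟨⟩i
        ... | inj₁ (d , refl) with d ≟B s
        ... | yes refl = j⟨⟩i
        ... | no d≢s with refl ← ¬-not d≢s = ⟨⟩-trans s (proj₁ (ordered f s)) (⟨⟩-trans s (proj₂ (ordered f s)) j⟨⟩i)

    nested-step : Nested c′ (fired r (site f))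
    nested-step = record
      { passed  = λ p → passed′ p (x ≟V (s ∷ p)) (x ≟V p)
      ; settled = λ p → settled′ p (x ≟V p)
      }

module _ (m : ℕ) {N : ℕ} where

  RootBetween : Config N → (Vertex → ℕ) → Set
  RootBetween c r = r [] ≡ 0 → Σ (Bool → Fin N) λ i → ∃ λ j →
    (∀ s → lookup c (i s) ≡ s ∷ [] × i s ⟨ s ⟩ j) × lookup c j ≡ []

  -- The last fire of the root puts its outer chips on the children and keeps the middle one. By
  -- `behind` the children have no fires left, so all three stay.
  rootBetween-step : ∀ {c c′ : Config N} {r} → Balanced m c r → (f : Firing c c′) → RootBetween c r → RootBetween c′ (fired r (site f))
  rootBetween-step {c} {c′} {r} B f R r′≡0 = go (x ≟V [])
    where
    open Balanced B
    open Step m B f using (x; not-site)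
    go : Dec (x ≡ []) → Σ (Bool → Fin N) λ i → ∃ λ j → (∀ s → lookup c′ (i s) ≡ s ∷ [] × i s ⟨ s ⟩ j) × lookup c′ j ≡ []
    go (yes x≡[]) = child f , middle f , (λ s → trans (child-to f s) (cong (s ∷_) x≡[]) , proj₁ (ordered f s)) , trans (mid-to f) (cong parent x≡[])
    go (no x≢[]) with R (trans (sym (fired-≢ r x≢[])) r′≡0)
    ... | i , j , i-at , j-at = i , j , (λ s → unmoved f (proj₁ (i-at s)) (not-site (child-0 s)) , proj₂ (i-at s)) , unmoved f j-at (x≢[] ∘ sym)
      where
      child-0 : ∀ d → r (d ∷ []) ≡ 0
      child-0 d = n≤0⇒n≡0 (subst (r (d ∷ []) ≤_) (trans (sym (fired-≢ r x≢[])) r′≡0) (behind d [] (subst (_≤ height m (d ∷ [])) (sym (trans (sym (fired-≢ r x≢[])) r′≡0)) z≤n)))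

-- One of the two s-most chips.
Extreme : ∀ {N} → Bool → Fin N → Set
Extreme s i = ∀ {j k} → j ⟨ s ⟩ k → ¬ k ⟨ s ⟩ i

OnChain : ∀ {N} → Bool → Config N → Set
OnChain s c = ∀ i → Extreme s i → All (_≡ s) (lookup c i)

-- The far chip of a fire has two others before it and so is not extreme: an extreme chip only steps
-- down to side `s` or up to the parent.
onChain-step : ∀ {N} {c c′ : Config N} s → Firing c c′ → OnChain s c → OnChain s c′
onChain-step {c = c} {c′} s f on i ext with fate f i
... | rests p q = subst (All (_≡ s)) (sym (stays f i p q)) (on i ext)
... | toParent refl = subst (All (_≡ s)) (sym (mid-to f)) (up (site f) (subst (All (_≡ s)) (mid-at f) (on i ext)))
  where
  up : ∀ v → All (_≡ s) v → All (_≡ s) (parent v)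
  up [] a = a
  up (_ ∷ v) (_ ∷ a) = a
... | toChild d refl with d ≟B s
... | yes refl = subst (All (_≡ s)) (sym (child-to f d)) (refl ∷ subst (All (_≡ s)) (child-at f d) (on i ext))
... | no d≢s with refl ← ¬-not d≢s = contradiction (proj₂ (ordered f s)) (ext (proj₁ (ordered f s)))

module Final (m : ℕ) {c : Config (2 ^ m ∸ 1)} (reached : Reachable c) (stable : IsStable c) where

  single : ∀ v → length v < m → chipsAt c v ≡ 1
  -- The invariant is trivial, any inhabited type would do; only `Balanced` is wanted.
  single with run m (λ _ _ → Vertex) [] (λ _ _ _ → []) reached
  ... | _ , B , _ = one-chip m B stable

  none : ∀ v → m ≤ length v → chipsAt c v ≡ 0
  none with run m (λ _ _ → Vertex) [] (λ _ _ _ → []) reached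
  ... | _ , B , _ = Balanced.outside B

  -- At the end `r` is 0, hence below the height of every vertex above the last layer. In
  -- contrapositive form, with `Z` the chips up to a given one, this places the `s`-most chip of a
  -- subtree on its side `s`.
  free-subtree : ∀ s (Z : Fin (2 ^ m ∸ 1) → Set) → (∀ {i j} → Z i → j ⟨ s ⟩ i → Z j) → ∀ v → suc (length v) < m →
                 (∀ i → Z i → ¬ Below (s ∷ v) (lookup c i)) → ∀ i → Z i → ¬ Below v (lookup c i)
  free-subtree s Z closed v v<m with run m Swept start swept-step reached
    where
    open Sweep m s Z closed
    start : Swept (initial _) (initially m)
    start = record
      { sides = λ v fr i Zi (t , eq) → case trans (sym (lookup-replicate i [])) eq of λ e → nonempty t e
      ; clean = λ v lt → contradiction (height≤fires (height m v)) (<⇒≱ lt)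
      ; relay = λ q lt → contradiction (height≤fires (height m (not s ∷ q))) (<⇒≱ lt)
      }
      where
      nonempty : ∀ t {d : Bool} {v : Vertex} → [] ≡ t ++ d ∷ v → ⊥
      nonempty [] ()
      nonempty (_ ∷ _) ()
  ... | r , B , S = Sweep.Swept.free S v (subst (_< height m v) (sym (finished m B stable v)) (m<n⇒0<n∸m v<m))

  side-order : ∀ s p → 2 + length p < m → ∃₂ λ i j → lookup c i ≡ not s ∷ s ∷ p × lookup c j ≡ s ∷ p × j ⟨ s ⟩ i
  side-order s p p<m with run m (Nesting.Nested m s) start (Nesting.nested-step m s) reached
    where
    start : Nesting.Nested m s (initial _) (initially m)
    start = record
      { passed  = λ p h u≡0 _ → contradiction (height≤fires (height m (s ∷ p))) (<⇒≱ (subst (_< height m (s ∷ p)) (sym u≡0) h))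
      ; settled = λ p h p≡0 → contradiction (height≤fires (height m p)) (<⇒≱ (subst (_< height m p) (sym p≡0) (<-trans (s≤s z≤n) (<height-∷ m {s} {p} h))))
      }
  ... | r , B , E = Nesting.Nested.settled E p (m<n⇒0<n∸m p<m) (finished m B stable p)

  root-between : 1 < m → Σ (Bool → Fin (2 ^ m ∸ 1)) λ i → ∃ λ j → (∀ s → lookup c (i s) ≡ s ∷ [] × i s ⟨ s ⟩ j) × lookup c j ≡ []
  root-between 1<m with run m (RootBetween m) start (rootBetween-step m) reached
    where
    start : RootBetween m (initial _) (initially m)
    start r≡0 = contradiction (height≤fires (height m [])) (<⇒≱ (subst (_< height m []) (sym r≡0) (m<n⇒0<n∸m 1<m)))
  ... | r , B , R = R (finished m B stable [])

  on-chain : ∀ s → OnChain s c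
  on-chain s = go reached (λ i _ → subst (All (_≡ s)) (sym (lookup-replicate i [])) [])
    where
    go : ∀ {c d} → Star Fire c d → OnChain s c → OnChain s d
    go ε on = on
    go (f ◅ fs) on = go fs (onChain-step s (firing f) on)

  -- An extreme chip at the root would have only one chip before it, the one at `s ∷ []`. With `Z`
  -- the chips up to that one, the `s`-subtree of `s ∷ []` would be free of `Z`, hence also the
  -- subtree of `s ∷ []`, against the chip at its top.
  extreme-below : 2 < m → ∀ s i → Extreme s i → Below (s ∷ []) (lookup c i)
  extreme-below 2<m s i ext with lookup c i in at | on-chain s i ext
  ... | [] | [] = ⊥-elim (free-subtree s (λ k → ¬ i′ ⟨ s ⟩ k) (⟨⟩-closed s) (s ∷ []) 2<m free i′ (⟨⟩-irrefl s i′) (subst (Below (s ∷ [])) (sym (proj₁ (at′ s))) below-refl))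
    where
    between = root-between (<-trans ≤-refl 2<m)
    at′ = λ d → proj₁ (proj₂ (proj₂ between)) d
    i′ = proj₁ between s
    i≡ : proj₁ (proj₂ between) ≡ i
    i≡ = chipsAt≤1⇒≡ c (≤-reflexive (single [] (<-trans (s≤s z≤n) 2<m))) (proj₂ (proj₂ (proj₂ between))) at
    free : ∀ k → ¬ i′ ⟨ s ⟩ k → ¬ Below (s ∷ s ∷ []) (lookup c k)
    free k i′≮k b with ⟨⟩-total s i′ k
    ... | inj₁ i′<k = i′≮k i′<k
    ... | inj₂ (inj₁ i′≡k) = ¬below-parent (subst (Below (s ∷ s ∷ [])) (trans (cong (lookup c) (sym i′≡k)) (proj₁ (at′ s))) b)
    ... | inj₂ (inj₂ k<i′) = ext k<i′ (subst (i′ ⟨ s ⟩_) i≡ (proj₂ (at′ s)))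
  ... | d ∷ v | refl ∷ a = chain v a
    where
    chain : ∀ v → All (_≡ s) v → Below (s ∷ []) (s ∷ v)
    chain [] [] = below-refl
    chain (_ ∷ v) (refl ∷ a) = below-∷ s (chain v a)

-- Words

-- Vertices store their last step first, so the last entry of a position relative to v tells on which side of v it lies.
Letter : Set
Letter = Maybe Bool

pattern lt  = just false
pattern rt  = just true
pattern top = nothing

_≟L_ : DecidableEquality Letter
_≟L_ = Maybe.≡-dec _≟B_

occ : Letter → List Letter → ℕ
occ x w = length (filter (_≟L x) w)

occ-++ : ∀ x w w′ → occ x (w ++ w′) ≡ occ x w + occ x w′
occ-++ x [] w′ = refl
occ-++ x (y ∷ w) w′ with y ≟L x
... | yes _ = cong suc (occ-++ x w w′)
... | no  _ = occ-++ x w w′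

words leftWords rightWords topWords : ℕ → ℕ → ℕ → List (List Letter)
words zero zero zero = [] ∷ []
words a b c = leftWords a b c ++ rightWords a b c ++ topWords a b c
leftWords zero    b c = []
leftWords (suc a) b c = map (lt ∷_) (words a b c)
rightWords a zero    c = []
rightWords a (suc b) c = map (rt ∷_) (words a b c)
topWords a b zero    = []
topWords a b (suc c) = map (top ∷_) (words a b c)

words-unfold : ∀ a b c {n} → a + b + c ≡ suc n → words a b c ≡ leftWords a b c ++ rightWords a b c ++ topWords a b c
words-unfold zero    zero    (suc c) _ = refl
words-unfold zero    (suc b) c       _ = refl
words-unfold (suc a) b       c       _ = refl

rt∷-∈-words : ∀ a b c {w} → w ∈ words a b c → rt ∷ w ∈ words a (suc b) c
rt∷-∈-words a b c w∈ = subst (_ ∈_) (sym (words-unfold a (suc b) c (cong (_+ c) (+-suc a b))))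
  (∈-++⁺ʳ (leftWords a (suc b) c) (∈-++⁺ˡ (∈-map⁺ (rt ∷_) w∈)))

top∷-∈-words : ∀ a b c {w} → w ∈ words a b c → top ∷ w ∈ words a b (suc c)
top∷-∈-words a b c w∈ = subst (_ ∈_) (sym (words-unfold a b (suc c) (+-suc (a + b) c)))
  (∈-++⁺ʳ (leftWords a b (suc c)) (∈-++⁺ʳ (rightWords a b (suc c)) (∈-map⁺ (top ∷_) w∈)))

∈-words : ∀ w → w ∈ words (occ lt w) (occ rt w) (occ top w)
∈-words [] = here refl
∈-words (lt ∷ w)  = ∈-++⁺ˡ (∈-map⁺ (lt ∷_) (∈-words w))
∈-words (rt ∷ w)  = rt∷-∈-words (occ lt w) (occ rt w) (occ top w) (∈-words w)
∈-words (top ∷ w) = top∷-∈-words (occ lt w) (occ rt w) (occ top w) (∈-words w)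

-- Split by the first letter: scaled by a! b! c!, the words of length n + 1 starting with `lt`,
-- `rt`, `top` contribute a n!, b n! and c n!, and a + b + c = n + 1.
length-words : ∀ n a b c → a + b + c ≡ n → length (words a b c) * (a ! * b ! * c !) ≡ n !
length-words zero zero zero zero _ = refl
length-words (suc n) a b c a+b+c≡ = begin
  length (words a b c) * (a ! * b ! * c !)
    ≡⟨ cong (λ ws → length ws * (a ! * b ! * c !)) (words-unfold a b c a+b+c≡) ⟩
  length (leftWords a b c ++ rightWords a b c ++ topWords a b c) * (a ! * b ! * c !)
    ≡⟨ cong (_* (a ! * b ! * c !)) (trans (length-++ (leftWords a b c)) (cong (length (leftWords a b c) +_) (length-++ (rightWords a b c)))) ⟩
  (length (leftWords a b c) + (length (rightWords a b c) + length (topWords a b c))) * (a ! * b ! * c !)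
    ≡⟨ distrib (length (leftWords a b c)) (length (rightWords a b c)) (length (topWords a b c)) (a ! * b ! * c !) ⟩
  length (leftWords a b c) * (a ! * b ! * c !) + length (rightWords a b c) * (a ! * b ! * c !) + length (topWords a b c) * (a ! * b ! * c !)
    ≡⟨ cong₂ _+_ (cong₂ _+_ (lefts a b c a+b+c≡) (rights a b c a+b+c≡)) (tops a b c a+b+c≡) ⟩
  a * n ! + b * n ! + c * n !
    ≡⟨ trans (cong (_+ c * n !) (sym (*-distribʳ-+ (n !) a b))) (sym (*-distribʳ-+ (n !) (a + b) c)) ⟩
  (a + b + c) * n !
    ≡⟨ cong (_* n !) a+b+c≡ ⟩
  suc n ! ∎
  where
  open ≡-Reasoning
  distrib : ∀ x y z f → (x + (y + z)) * f ≡ x * f + y * f + z * f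
  distrib = solve-∀
  lefts : ∀ a b c → a + b + c ≡ suc n → length (leftWords a b c) * (a ! * b ! * c !) ≡ a * n !
  lefts zero b c _ = refl
  lefts (suc a) b c eq = begin
    length (map (lt ∷_) (words a b c)) * (suc a * a ! * b ! * c !) ≡⟨ cong (_* (suc a * a ! * b ! * c !)) (length-map (lt ∷_) (words a b c)) ⟩
    length (words a b c) * (suc a * a ! * b ! * c !)               ≡⟨ move (length (words a b c)) (suc a) (a !) (b !) (c !) ⟩
    suc a * (length (words a b c) * (a ! * b ! * c !))             ≡⟨ cong (suc a *_) (length-words n a b c (suc-injective eq)) ⟩
    suc a * n !                                                    ∎
    where move : ∀ l x a b c → l * (x * a * b * c) ≡ x * (l * (a * b * c))
          move = solve-∀
  rights : ∀ a b c → a + b + c ≡ suc n → length (rightWords a b c) * (a ! * b ! * c !) ≡ b * n !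
  rights a zero c _ = refl
  rights a (suc b) c eq = begin
    length (map (rt ∷_) (words a b c)) * (a ! * (suc b * b !) * c !) ≡⟨ cong (_* (a ! * (suc b * b !) * c !)) (length-map (rt ∷_) (words a b c)) ⟩
    length (words a b c) * (a ! * (suc b * b !) * c !)               ≡⟨ move (length (words a b c)) (suc b) (a !) (b !) (c !) ⟩
    suc b * (length (words a b c) * (a ! * b ! * c !))               ≡⟨ cong (suc b *_) (length-words n a b c (suc-injective (trans (cong (_+ c) (sym (+-suc a b))) eq))) ⟩
    suc b * n !                                                      ∎
    where move : ∀ l x a b c → l * (a * (x * b) * c) ≡ x * (l * (a * b * c))
          move = solve-∀
  tops : ∀ a b c → a + b + c ≡ suc n → length (topWords a b c) * (a ! * b ! * c !) ≡ c * n !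
  tops a b zero _ = refl
  tops a b (suc c) eq = begin
    length (map (top ∷_) (words a b c)) * (a ! * b ! * (suc c * c !)) ≡⟨ cong (_* (a ! * b ! * (suc c * c !))) (length-map (top ∷_) (words a b c)) ⟩
    length (words a b c) * (a ! * b ! * (suc c * c !))                ≡⟨ move (length (words a b c)) (suc c) (a !) (b !) (c !) ⟩
    suc c * (length (words a b c) * (a ! * b ! * c !))                ≡⟨ cong (suc c *_) (length-words n a b c (suc-injective (trans (sym (+-suc (a + b) c)) eq))) ⟩
    suc c * n !                                                       ∎
    where move : ∀ l x a b c → l * (a * b * (x * c)) ≡ x * (l * (a * b * c))
          move = solve-∀

strip : Bool → Vertex → Maybe Vertex
strip b [] = nothing
strip b (c ∷ []) with c ≟B b
... | yes _ = just []
... | no  _ = nothing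
strip b (c ∷ w@(_ ∷ _)) = Maybe.map (c ∷_) (strip b w)

branch : Bool → List Vertex → List Vertex
branch b = mapMaybe (strip b)

last-∷ʳ : ∀ (w : Vertex) b → last (w ∷ʳ b) ≡ just b
last-∷ʳ [] b = refl
last-∷ʳ (c ∷ []) b = refl
last-∷ʳ (c ∷ d ∷ w) b = last-∷ʳ (d ∷ w) b

strip-∷ʳ : ∀ w b → strip b (w ∷ʳ b) ≡ just w
strip-∷ʳ [] true = refl
strip-∷ʳ [] false = refl
strip-∷ʳ (c ∷ []) b = cong (Maybe.map (c ∷_)) (strip-∷ʳ [] b)
strip-∷ʳ (c ∷ d ∷ w) b = cong (Maybe.map (c ∷_)) (strip-∷ʳ (d ∷ w) b)

strip-not : ∀ w b → strip (not b) (w ∷ʳ b) ≡ nothing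
strip-not [] true = refl
strip-not [] false = refl
strip-not (c ∷ []) b = cong (Maybe.map (c ∷_)) (strip-not [] b)
strip-not (c ∷ d ∷ w) b = cong (Maybe.map (c ∷_)) (strip-not (d ∷ w) b)

branch-∷ʳ : ∀ b w p → branch b ((w ∷ʳ b) ∷ p) ≡ w ∷ branch b p
branch-∷ʳ b w p rewrite strip-∷ʳ w b = refl

branch-not : ∀ b w p → branch (not b) ((w ∷ʳ b) ∷ p) ≡ branch (not b) p
branch-not b w p rewrite strip-not w b = refl

letters : List Vertex → List Letter
letters = map last

occ-letters : ∀ b p → occ (just b) (letters p) ≡ length (branch b p)
occ-letters b [] = refl
occ-letters b (u ∷ p) with initLast u
occ-letters b (.[] ∷ p) | [] = occ-letters b p
occ-letters true  (._ ∷ p) | w ∷ʳ′ true  rewrite last-∷ʳ w true  | branch-∷ʳ true w p  = cong suc (occ-letters true p)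
occ-letters false (._ ∷ p) | w ∷ʳ′ false rewrite last-∷ʳ w false | branch-∷ʳ false w p = cong suc (occ-letters false p)
occ-letters true  (._ ∷ p) | w ∷ʳ′ false rewrite last-∷ʳ w false | branch-not false w p = occ-letters true p
occ-letters false (._ ∷ p) | w ∷ʳ′ true  rewrite last-∷ʳ w true  | branch-not true w p  = occ-letters false p

encode : List Vertex → List Letter × List Vertex × List Vertex
encode p = letters p , branch false p , branch true p

-- The word tells for every rank which branch supplies the next entry, so the two branches can be
-- merged back in one way only.
encode-injective : ∀ p q → letters p ≡ letters q → branch false p ≡ branch false q → branch true p ≡ branch true q → p ≡ q
encode-injective [] [] _ _ _ = refl
encode-injective (u ∷ p) (v ∷ q) ls fs ts with initLast u | initLast v
encode-injective (._ ∷ p) (._ ∷ q) ls fs ts | [] | [] = cong ([] ∷_) (encode-injective p q (proj₂ (∷-injective ls)) fs ts)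
encode-injective (._ ∷ p) (._ ∷ q) ls fs ts | [] | w ∷ʳ′ b with () ← trans (proj₁ (∷-injective ls)) (last-∷ʳ w b)
encode-injective (._ ∷ p) (._ ∷ q) ls fs ts | w ∷ʳ′ b | [] with () ← trans (sym (last-∷ʳ w b)) (proj₁ (∷-injective ls))
encode-injective (._ ∷ p) (._ ∷ q) ls fs ts | w ∷ʳ′ b | x ∷ʳ′ c
  with refl ← trans (sym (last-∷ʳ w b)) (trans (proj₁ (∷-injective ls)) (last-∷ʳ x c)) = go b fs ts
  where
  go : ∀ b → branch false ((w ∷ʳ b) ∷ p) ≡ branch false ((x ∷ʳ b) ∷ q) → branch true ((w ∷ʳ b) ∷ p) ≡ branch true ((x ∷ʳ b) ∷ q) →
       (w ∷ʳ b) ∷ p ≡ (x ∷ʳ b) ∷ q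
  go true fs ts rewrite branch-∷ʳ true w p | branch-∷ʳ true x q | branch-not true w p | branch-not true x q =
    cong₂ (λ y r → (y ∷ʳ true) ∷ r) (proj₁ (∷-injective ts)) (encode-injective p q (proj₂ (∷-injective ls)) fs (proj₂ (∷-injective ts)))
  go false fs ts rewrite branch-∷ʳ false w p | branch-∷ʳ false x q | branch-not false w p | branch-not false x q =
    cong₂ (λ y r → (y ∷ʳ false) ∷ r) (proj₁ (∷-injective fs)) (encode-injective p q (proj₂ (∷-injective ls)) (proj₂ (∷-injective fs)) ts)

AtMost-encode : {P PL PR : List Vertex → Set} {PW : List Letter → Set} {k m n : ℕ} → AtMost PW k → AtMost PL m → AtMost PR n →
                (∀ {p} → P p → PW (letters p) × PL (branch false p) × PR (branch true p)) → AtMost P (k * (m * n))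
AtMost-encode PW≤k PL≤m PR≤n enc = AtMost-injective encode enc
  (λ {p} {q} _ _ eq → encode-injective p q (cong proj₁ eq) (cong (proj₁ ∘ proj₂) eq) (cong (proj₂ ∘ proj₂) eq))
  (AtMost-× (≡-dec _≟L_) (Product.≡-dec (≡-dec _≟V_) (≡-dec _≟V_)) PW≤k (AtMost-× (≡-dec _≟V_) (≡-dec _≟V_) PL≤m PR≤n))

-- Windows

length-++-∸ : ∀ (w v : Vertex) → length (w ++ v) ∸ length v ≡ length w
length-++-∸ w v = trans (cong (_∸ length v) (length-++ w)) (m+n∸n≡m (length w) (length v))

relative-++ : ∀ v w → relative v (w ++ v) ≡ just w
relative-++ v w with drop (length (w ++ v) ∸ length v) (w ++ v) ≟V v
... | yes _ = cong just (trans (cong (λ n → take n (w ++ v)) (length-++-∸ w v)) (take-length w))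
  where
  take-length : ∀ w → take (length w) (w ++ v) ≡ w
  take-length [] = refl
  take-length (s ∷ w) = cong (s ∷_) (take-length w)
... | no drop≢ = contradiction (trans (cong (λ n → drop n (w ++ v)) (length-++-∸ w v)) (drop-length w)) drop≢
  where
  drop-length : ∀ w → drop (length w) (w ++ v) ≡ v
  drop-length [] = refl
  drop-length (s ∷ w) = drop-length w

relative⁻ : ∀ v u {w} → relative v u ≡ just w → u ≡ w ++ v
relative⁻ v u eq with drop (length u ∸ length v) u ≟V v | eq
... | yes drop≡ | refl = trans (sym (take++drop≡id (length u ∸ length v) u)) (cong (take (length u ∸ length v) u ++_) drop≡)

inWindow-++ : ∀ {ℓ} v w → length w < ℓ → inWindow ℓ v (w ++ v) ≡ just w
inWindow-++ {ℓ} v w w<ℓ rewrite relative-++ v w = cong (if_then just w else nothing) (Equivalence.to T-≡ (<⇒<ᵇ w<ℓ))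

inWindow⁻ : ∀ {ℓ} v u {w} → inWindow ℓ v u ≡ just w → u ≡ w ++ v × length w < ℓ
inWindow⁻ {ℓ} v u eq with relative v u in rel
... | just y with length y <ᵇ ℓ in y<ᵇℓ | eq
... | true | refl = relative⁻ v u rel , <ᵇ⇒< (length y) ℓ (Equivalence.from T-≡ y<ᵇℓ)

∷ʳ-≢[] : ∀ (w : Vertex) {b} → w ∷ʳ b ≢ []
∷ʳ-≢[] [] ()
∷ʳ-≢[] (_ ∷ _) ()

-- Both sides test whether `u` is `w ++ b ∷ v` with `w` shorter than ℓ; one reads `w ∷ʳ b` relative
-- to `v`, the other `w` relative to `b ∷ v`.
strip-inWindow : ∀ ℓ b v u → (inWindow (suc ℓ) v u >>= strip b) ≡ inWindow ℓ (b ∷ v) u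
strip-inWindow ℓ b v u with inWindow (suc ℓ) v u in outer | inWindow ℓ (b ∷ v) u in inner
... | nothing | nothing = refl
... | nothing | just w with inWindow⁻ (b ∷ v) u inner
... | refl , w<ℓ = case trans (sym outer) (trans (cong (inWindow (suc ℓ) v) (sym (++-assoc w (b ∷ []) v))) (inWindow-++ v (w ∷ʳ b) (subst (_< suc ℓ) (sym (length-∷ʳ w)) (s≤s w<ℓ)))) of λ ()
  where
  length-∷ʳ : ∀ w → length (w ∷ʳ b) ≡ suc (length w)
  length-∷ʳ w = trans (length-++ w) (+-comm (length w) 1)
strip-inWindow ℓ b v u | just y | z with inWindow⁻ v u outer | initLast y
... | refl , y<ℓ | [] with z
...   | nothing = refl
...   | just w = contradiction (proj₁ (inWindow⁻ (b ∷ v) v inner)) (¬below-parent ∘ (w ,_))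
strip-inWindow ℓ b v u | just y | z | refl , y<ℓ | w ∷ʳ′ d with d ≟B b
... | yes refl = trans (strip-∷ʳ w b) (trans (sym (inWindow-++ (b ∷ v) w w<ℓ)) (trans (cong (inWindow ℓ (b ∷ v)) (sym (++-assoc w (b ∷ []) v))) inner))
  where
  w<ℓ : length w < ℓ
  w<ℓ = s≤s⁻¹ (subst (_< suc ℓ) (trans (length-++ w) (+-comm (length w) 1)) y<ℓ)
... | no d≢b with z
...   | nothing = trans (cong (λ b → strip b (w ∷ʳ d)) (¬-not (d≢b ∘ sym))) (strip-not w d)
...   | just w′ = contradiction (proj₂ (∷ʳ-injective w w′ (++-cancelʳ v (w ∷ʳ d) (w′ ∷ʳ b) (trans (proj₁ (inWindow⁻ (b ∷ v) _ inner)) (sym (++-assoc w′ (b ∷ []) v)))))) d≢b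

branch-pattern : ∀ {N} ℓ b v (c : Config N) → branch b (pattern′ (suc ℓ) v c) ≡ pattern′ ℓ (b ∷ v) c
branch-pattern ℓ b v c = go (toList c)
  where
  go : ∀ us → branch b (mapMaybe (inWindow (suc ℓ) v) us) ≡ mapMaybe (inWindow ℓ (b ∷ v)) us
  go [] = refl
  go (u ∷ us) with inWindow (suc ℓ) v u | inWindow ℓ (b ∷ v) u | strip-inWindow ℓ b v u
  ... | nothing | nothing | _ = go us
  ... | just y | z | eq with strip b y | z | eq
  ... | nothing | nothing | _ = go us
  ... | just _ | just _ | refl = cong (_ ∷_) (go us)

pattern-0 : ∀ {N} v (c : Config N) → pattern′ 0 v c ≡ []
pattern-0 v c = go (toList c)
  where
  go : ∀ us → mapMaybe (inWindow 0 v) us ≡ []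
  go [] = refl
  go (u ∷ us) with inWindow 0 v u in eq
  ... | nothing = go us
  ... | just w = contradiction (proj₂ (inWindow⁻ v u eq)) λ ()

occ-top-pattern : ∀ {N} ℓ v (c : Config N) → occ top (letters (pattern′ (suc ℓ) v c)) ≡ chipsAt c v
occ-top-pattern ℓ v c = go (toList c)
  where
  go : ∀ us → occ top (letters (mapMaybe (inWindow (suc ℓ) v) us)) ≡ length (filter (λ w → w ≟V v) us)
  go [] = refl
  go (u ∷ us) with u ≟V v
  ... | yes refl rewrite inWindow-++ {suc ℓ} u [] (s≤s z≤n) = cong suc (go us)
  ... | no u≢v with inWindow (suc ℓ) v u in eq
  ... | nothing = go us
  ... | just y with initLast y
  ... | [] = contradiction (proj₁ (inWindow⁻ v u eq)) u≢v
  ... | w ∷ʳ′ d rewrite last-∷ʳ w d with d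
  ... | true = go us
  ... | false = go us

End : {A : Set} → Bool → List A → A → Set
End false p y = ∃ λ ys → p ≡ y ∷ ys
End true  p y = ∃ λ ys → p ≡ ys ∷ʳ y

mapMaybe-nothing⁻ : ∀ {N} {A B : Set} (f : A → Maybe B) (c : Vec A N) → mapMaybe f (toList c) ≡ [] → ∀ j → f (lookup c j) ≡ nothing
mapMaybe-nothing⁻ f (u ∷ c) eq zero with f u | eq
... | nothing | _ = refl
mapMaybe-nothing⁻ f (u ∷ c) eq (suc j) with f u | eq
... | nothing | eq′ = mapMaybe-nothing⁻ f c eq′ j

End-mapMaybe : ∀ {N} {A B : Set} s (f : A → Maybe B) (c : Vec A N) {y} → End s (mapMaybe f (toList c)) y →
               ∃ λ i → f (lookup c i) ≡ just y × (∀ j → j ⟨ s ⟩ i → f (lookup c j) ≡ nothing)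
End-mapMaybe false f (u ∷ c) (ys , eq) with f u in fu | eq
... | just _ | refl = zero , fu , λ j ()
... | nothing | eq′ with End-mapMaybe false f c (ys , eq′)
... | i , fi , before = suc i , fi , λ { zero _ → fu ; (suc j) (s≤s j<i) → before j j<i }
End-mapMaybe true f [] ([] , ())
End-mapMaybe true f [] (_ ∷ _ , ())
End-mapMaybe true f (u ∷ c) (ys , eq) with f u in fu | eq
... | nothing | eq′ with End-mapMaybe true f c (ys , eq′)
... | i , fi , after = suc i , fi , λ { (suc j) (s≤s i<j) → after j i<j }
End-mapMaybe true f (u ∷ c) ([] , _) | just _ | eq′ with ∷-injective eq′
... | refl , rest = zero , fu , λ { (suc j) _ → mapMaybe-nothing⁻ f c rest j }
End-mapMaybe true f (u ∷ c) (_ ∷ ys , _) | just _ | eq′ with End-mapMaybe true f c (ys , ∷-injectiveʳ eq′)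
... | i , fi , after = suc i , fi , λ { (suc j) (s≤s i<j) → after j i<j }

mapMaybe-order : ∀ {N} {A B : Set} (f : A → Maybe B) (c : Vec A N) {i j y z} → f (lookup c i) ≡ just y → f (lookup c j) ≡ just z →
                 toℕ i < toℕ j → ∃₂ λ as bs → ∃ λ cs → mapMaybe f (toList c) ≡ as ++ y ∷ bs ++ z ∷ cs
mapMaybe-order f (u ∷ c) {zero} {suc j} fi fj _ rewrite fi = let bs , cs , eq = locate j c fj in [] , bs , cs , cong (_ ∷_) eq
  where
  locate : ∀ {N} j (c : Vec _ N) {z} → f (lookup c j) ≡ just z → ∃₂ λ bs cs → mapMaybe f (toList c) ≡ bs ++ z ∷ cs
  locate zero (u ∷ c) fj rewrite fj = [] , _ , refl
  locate (suc j) (u ∷ c) fj with locate j c fj | f u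
  ... | bs , cs , eq | nothing = bs , cs , eq
  ... | bs , cs , eq | just w = w ∷ bs , cs , cong (w ∷_) eq
mapMaybe-order f (u ∷ c) {suc i} {suc j} fi fj (s≤s i<j) with mapMaybe-order f c fi fj i<j | f u
... | as , bs , cs , eq | nothing = as , bs , cs , eq
... | as , bs , cs , eq | just w = w ∷ as , bs , cs , cong (w ∷_) eq

length-occ : ∀ w → length w ≡ occ lt w + occ rt w + occ top w
length-occ [] = refl
length-occ (lt ∷ w)  = cong suc (length-occ w)
length-occ (rt ∷ w)  = trans (cong suc (length-occ w)) (cong (_+ occ top w) (sym (+-suc (occ lt w) (occ rt w))))
length-occ (top ∷ w) = trans (cong suc (length-occ w)) (sym (+-suc (occ lt w + occ rt w) (occ top w)))

-- The first and the last letter are forced, and the 1 stands for the top chip. In size ℓ each side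
-- has 2^(ℓ-1) - 1 chips, so n will be 2^(ℓ-1) - 2.
patternWords : ℕ → List (List Letter)
patternWords n = map (λ w → lt ∷ (w ∷ʳ rt)) (words n n 1)

-- Two letters are forced at either end, so n will be 2^(ℓ-1) - 3 for 2^ℓ - 1 chips.
configWords : ℕ → List (List Letter)
configWords n = map (λ w → lt ∷ lt ∷ (w ++ rt ∷ rt ∷ [])) (words n n 1)

∈-words-occ : ∀ {a b c} w → occ lt w ≡ a → occ rt w ≡ b → occ top w ≡ c → w ∈ words a b c
∈-words-occ w refl refl refl = ∈-words w

∈-patternWords : ∀ {n} w → End false w lt → End true w rt → occ lt w ≡ suc n → occ rt w ≡ suc n → occ top w ≡ 1 → w ∈ patternWords n
∈-patternWords .(lt ∷ w) (w , refl) (w′ , eq) l≡ r≡ t≡ with initLast w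
... | [] = case ∷ʳ-injective [] w′ eq of λ { (_ , ()) }
... | mid ∷ʳ′ z with ∷ʳ-injective (lt ∷ mid) w′ eq
... | _ , refl = ∈-map⁺ (λ w → lt ∷ (w ∷ʳ rt)) (∈-words-occ mid
  (trans (sym (trans (occ-++ lt mid (rt ∷ [])) (+-identityʳ _))) (suc-injective l≡))
  (suc-injective (trans (sym (trans (occ-++ rt mid (rt ∷ [])) (+-comm (occ rt mid) 1))) r≡))
  (trans (sym (trans (occ-++ top mid (rt ∷ [])) (+-identityʳ _))) t≡))

∈-configWords : ∀ {n} w → occ lt w ≡ n → occ rt w ≡ n → occ top w ≡ 1 → lt ∷ lt ∷ (w ++ rt ∷ rt ∷ []) ∈ configWords n
∈-configWords w l≡ r≡ t≡ = ∈-map⁺ (λ w → lt ∷ lt ∷ (w ++ rt ∷ rt ∷ [])) (∈-words-occ w l≡ r≡ t≡)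

full≡suc : ∀ k → full (suc k) ≡ suc (2 ^ suc k ∸ 2)
full≡suc k = +-∸-assoc 1 {2 ^ suc k} {2} (^-monoʳ-≤ 2 {1} {suc k} (s≤s z≤n))

module Window (m : ℕ) {c : Config (2 ^ m ∸ 1)} (reached : Reachable c) (stable : IsStable c) where
  open Final m reached stable public

  short : ∀ i → length (lookup c i) < m
  short i = ≰⇒> λ m≤ → contradiction (chipsAt-lookup c i refl) (<⇒≱ (≤-reflexive (cong suc (none (lookup c i) m≤))))

  length-pattern : ∀ ℓ v → length v + ℓ ≡ m → length (pattern′ ℓ v c) ≡ full ℓ
  occ-pattern : ∀ ℓ b v → length v + suc ℓ ≡ m → occ (just b) (letters (pattern′ (suc ℓ) v c)) ≡ full ℓ
  occ-top : ∀ ℓ v → length v + suc ℓ ≡ m → occ top (letters (pattern′ (suc ℓ) v c)) ≡ 1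

  occ-pattern ℓ b v eq = trans (occ-letters b (pattern′ (suc ℓ) v c))
    (trans (cong length (branch-pattern ℓ b v c)) (length-pattern ℓ (b ∷ v) (trans (sym (+-suc (length v) ℓ)) eq)))
  occ-top ℓ v eq = trans (occ-top-pattern ℓ v c) (single v (subst (length v <_) eq (m<m+n (length v) (s≤s z≤n))))
  length-pattern zero v _ = cong length (pattern-0 v c)
  length-pattern (suc ℓ) v eq = begin
    length p                                      ≡⟨ length-map last p ⟨
    length (letters p)                            ≡⟨ length-occ (letters p) ⟩
    occ lt (letters p) + occ rt (letters p) + occ top (letters p)
      ≡⟨ cong₂ _+_ (cong₂ _+_ (occ-pattern ℓ false v eq) (occ-pattern ℓ true v eq)) (occ-top ℓ v eq) ⟩
    full ℓ + full ℓ + 1                           ≡⟨ +-comm (full ℓ + full ℓ) 1 ⟩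
    suc (full ℓ + full ℓ)                         ≡⟨ full-suc ℓ ⟨
    full (suc ℓ)                                  ∎
    where
    open ≡-Reasoning
    p = pattern′ (suc ℓ) v c

  -- Let `i` be the `s`-most chip of the window and `Z` the chips up to `i`. If `i` were not on side
  -- `s`, the `s`-subtree of `v` would be free of `Z`, hence also the subtree of `v`, which contains
  -- `i`.
  ends : ∀ ℓ v s {y} → length v + (2 + ℓ) ≡ m → End s (pattern′ (2 + ℓ) v c) y → last y ≡ just s
  ends ℓ v s {y} eq end with last y ≟L just s
  ... | yes last≡ = last≡
  ... | no last≢ with End-mapMaybe s (inWindow (2 + ℓ) v) c end
  ... | i , i-in , outer = contradiction (y , i-at) (free-subtree s (λ k → ¬ i ⟨ s ⟩ k) (⟨⟩-closed s) v v<m free i (⟨⟩-irrefl s i))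
    where
    i-at : lookup c i ≡ y ++ v
    i-at = proj₁ (inWindow⁻ v (lookup c i) i-in)
    v<m : suc (length v) < m
    v<m = subst (suc (length v) <_) (trans (sym (trans (+-suc (length v) (suc ℓ)) (cong suc (+-suc (length v) ℓ)))) eq) (s≤s (s≤s (m≤m+n (length v) ℓ)))
    free : ∀ k → ¬ i ⟨ s ⟩ k → ¬ Below (s ∷ v) (lookup c k)
    free k i≮k (t , k-at) with ⟨⟩-total s i k
    ... | inj₁ i<k = i≮k i<k
    ... | inj₂ (inj₁ refl) = last≢ (trans (cong last (++-cancelʳ v y (t ∷ʳ s) (trans (sym i-at) (trans k-at (sym (++-assoc t (s ∷ []) v)))))) (last-∷ʳ t s))
    ... | inj₂ (inj₂ k<i) = case trans (sym (outer k k<i)) (trans (cong (inWindow (2 + ℓ) v) (trans k-at (sym (++-assoc t (s ∷ []) v)))) (inWindow-++ v (t ∷ʳ s) fits)) of λ ()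
      where
      -- The window reaches down to the last layer, so no chip below `v` escapes it.
      fits : length (t ∷ʳ s) < 2 + ℓ
      fits = +-cancelʳ-< (length v) (length (t ∷ʳ s)) (2 + ℓ) (subst₂ _<_
        (trans (cong length (trans k-at (sym (++-assoc t (s ∷ []) v)))) (length-++ (t ∷ʳ s))) (trans (sym eq) (+-comm (length v) (2 + ℓ))) (short k))

  letters-pattern : ∀ ℓ v → length v + (2 + ℓ) ≡ m → letters (pattern′ (2 + ℓ) v c) ∈ patternWords (2 ^ suc ℓ ∸ 2)
  letters-pattern ℓ v eq = ∈-patternWords (letters p) first final
    (trans (occ-pattern (suc ℓ) false v eq) (full≡suc ℓ)) (trans (occ-pattern (suc ℓ) true v eq) (full≡suc ℓ)) (occ-top (suc ℓ) v eq)
    where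
    p = pattern′ (2 + ℓ) v c
    nonempty : length p ≡ suc (full (suc ℓ) + full (suc ℓ))
    nonempty = trans (length-pattern (2 + ℓ) v eq) (full-suc (suc ℓ))
    first : End false (letters p) lt
    first with p in p≡ | nonempty
    ... | y ∷ ys | _ = letters ys , cong (_∷ letters ys) (ends ℓ v false eq (ys , p≡))
    final : End true (letters p) rt
    final = go p refl (subst (_≢ 0) (sym nonempty) λ ())
      where
      go : ∀ q → p ≡ q → length q ≢ 0 → End true (letters q) rt
      go q p≡ ne with initLast q
      ... | [] = contradiction refl ne
      ... | zs ∷ʳ′ z = letters zs , trans (map-++ last zs (z ∷ [])) (cong (letters zs ∷ʳ_) (ends ℓ v true eq (zs , p≡)))

-- Patterns of size at most 3

AtMost-≡ : {A : Set} (x : A) → AtMost (_≡ x) 1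
AtMost-≡ x = AtMost-injective id here (λ _ _ eq → eq) (AtMost-∈ (x ∷ []))

SidePattern : Bool → ℕ → List Vertex → Set
SidePattern s ℓ p = ∃ λ m → ℓ < m × Σ (Config (2 ^ m ∸ 1)) λ c → StableConfig c ×
  ∃ λ v → length (s ∷ v) ≡ m ∸ ℓ × p ≡ pattern′ ℓ (s ∷ v) c

side⇒order : ∀ {s ℓ p} → SidePattern s ℓ p → IsOrderPattern ℓ p
side⇒order {s} (m , ℓ<m , c , st , v , len , eq) = m , ℓ<m , c , st , s ∷ v , len , eq

branch-side : ∀ {ℓ p} s → IsOrderPattern (suc ℓ) p → SidePattern s ℓ (branch s p)
branch-side {ℓ} s (m , ℓ<m , c , st , v , len , refl) =
  m , <-trans ≤-refl ℓ<m , c , st , v , trans (cong suc len) (sym (+-∸-assoc 1 {m} {suc ℓ} (<⇒≤ ℓ<m))) , branch-pattern ℓ s v c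

letters-order : ∀ {ℓ p} → IsOrderPattern (2 + ℓ) p → letters p ∈ patternWords (2 ^ suc ℓ ∸ 2)
letters-order {ℓ} (m , ℓ<m , c , (reached , stable) , v , len , refl) =
  Window.letters-pattern m reached stable ℓ v (trans (cong (_+ (2 + ℓ)) len) (m∸n+n≡m (<⇒≤ ℓ<m)))

singlePattern triplePattern : List Vertex
singlePattern = [] ∷ []
triplePattern = (false ∷ []) ∷ [] ∷ (true ∷ []) ∷ []

order-1 : ∀ {p} → IsOrderPattern 1 p → p ≡ singlePattern
order-1 (m , 1<m , c , (reached , stable) , v , len , refl) =
  encode-injective (pattern′ 1 v c) singlePattern letters≡ (empty false) (empty true)
  where
  open Window m reached stable
  len′ : length v + 1 ≡ m
  len′ = trans (cong (_+ 1) len) (m∸n+n≡m (<⇒≤ 1<m))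
  empty : ∀ b → branch b (pattern′ 1 v c) ≡ []
  empty b = trans (branch-pattern 0 b v c) (pattern-0 (b ∷ v) c)
  letters≡ : letters (pattern′ 1 v c) ≡ top ∷ []
  letters≡ with ∈-words-occ (letters (pattern′ 1 v c)) (occ-pattern 0 false v len′) (occ-pattern 0 true v len′) (occ-top 0 v len′)
  ... | here eq = eq

order-2 : ∀ {p} → IsOrderPattern 2 p → p ≡ triplePattern
order-2 {p} op = encode-injective p triplePattern letters≡
  (order-1 (side⇒order (branch-side false op))) (order-1 (side⇒order (branch-side true op)))
  where
  letters≡ : letters p ≡ lt ∷ top ∷ rt ∷ []
  letters≡ with letters-order {0} op
  ... | here eq = eq

beforeTop : Letter → List Letter → ℕ
beforeTop x [] = 0
beforeTop x (top ∷ w) = 0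
beforeTop x (just b ∷ w) = occ x (just b ∷ []) + beforeTop x w

beforeTop-++ : ∀ x w w′ → occ top w ≡ 0 → beforeTop x (w ++ top ∷ w′) ≡ occ x w
beforeTop-++ x [] w′ _ = refl
beforeTop-++ x (lt ∷ w) w′ eq = trans (cong (occ x (lt ∷ []) +_) (beforeTop-++ x w w′ eq)) (sym (occ-++ x (lt ∷ []) w))
beforeTop-++ x (rt ∷ w) w′ eq = trans (cong (occ x (rt ∷ []) +_) (beforeTop-++ x w w′ eq)) (sym (occ-++ x (rt ∷ []) w))

-- In a window of size 3 the two subtrees have pattern triplePattern, so the second lt stands for the left child
-- and the second rt for the right child.
SideCond : Bool → List Letter → Set
SideCond true  w = 2 ≤ beforeTop lt w
SideCond false w = beforeTop rt w ≤ 1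

sideCond? : ∀ s → Decidable (SideCond s)
sideCond? true  w = 2 ≤? beforeTop lt w
sideCond? false w = beforeTop rt w ≤? 1

SideWord : Bool → List Letter → Set
SideWord s w = w ∈ patternWords (2 ^ 2 ∸ 2) × SideCond s w

triple-middle : ∀ xs {ys} → xs ++ [] ∷ ys ≡ triplePattern → length xs ≡ 1
triple-middle [] ()
triple-middle (x ∷ []) eq = refl
triple-middle (x ∷ y ∷ []) ()
triple-middle (x ∷ y ∷ z ∷ []) ()
triple-middle (x ∷ y ∷ z ∷ w ∷ xs) ()

-- `side-order` compares the chip at the top of the window with the one at its child on the side
-- `not s`. In `triplePattern` that child comes second, which turns the comparison into a count of
-- letters before `top`.
order-3 : ∀ {s p} → SidePattern s 3 p → SideWord s (letters p) × branch false p ≡ triplePattern × branch true p ≡ triplePattern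
order-3 {s} {p} sp@(m , 3<m , c , (reached , stable) , v , len , p≡) = (letters-order {1} (side⇒order sp) , sided s refl) , sub false , sub true
  where
  open Window m reached stable
  u = s ∷ v
  len′ : suc (length v) + 3 ≡ m
  len′ = trans (cong (_+ 3) len) (m∸n+n≡m (<⇒≤ 3<m))
  sub : ∀ b → branch b p ≡ triplePattern
  sub b = order-2 (side⇒order (branch-side b (side⇒order sp)))
  one-top : occ top (letters p) ≡ 1
  one-top = trans (cong (occ top ∘ letters) p≡) (occ-top 2 u len′)
  no-top : ∀ w w′ → letters p ≡ w ++ top ∷ w′ → occ top w ≡ 0
  no-top w w′ eq = m+n≡0⇒m≡0 (occ top w) (suc-injective (trans (sym (+-suc _ _)) (trans (sym (occ-++ top w (top ∷ w′))) (trans (cong (occ top) (sym eq)) one-top))))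
  order = side-order s v (subst (2 + length v <_) len′ (s≤s (≤-trans (n≤1+n _) (≤-reflexive (+-comm 3 (length v))))))
  i = proj₁ order
  j = proj₁ (proj₂ order)
  i-in : inWindow 3 u (lookup c i) ≡ just (not s ∷ [])
  i-in = trans (cong (inWindow 3 u) (proj₁ (proj₂ (proj₂ order)))) (inWindow-++ u (not s ∷ []) (s≤s (s≤s z≤n)))
  j-in : inWindow 3 u (lookup c j) ≡ just []
  j-in = trans (cong (inWindow 3 u) (proj₁ (proj₂ (proj₂ (proj₂ order))))) (inWindow-++ u [] (s≤s z≤n))
  j⟨s⟩i = proj₂ (proj₂ (proj₂ (proj₂ order)))
  sided : ∀ t → t ≡ s → SideCond t (letters p)
  sided true refl with mapMaybe-order (inWindow 3 u) c i-in j-in j⟨s⟩i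
  ... | as , bs , cs , eq = begin
    2                                             ≤⟨ s≤s (s≤s z≤n) ⟩
    suc (suc (length (branch false bs)))          ≡⟨ cong (_+ suc (length (branch false bs))) (triple-middle (branch false as) left) ⟨
    length (branch false as) + suc (length (branch false bs)) ≡⟨ length-++ (branch false as) ⟨
    length (branch false as ++ [] ∷ branch false bs) ≡⟨ cong length (mapMaybe-++ (strip false) as ((false ∷ []) ∷ bs)) ⟨
    length (branch false pre)                     ≡⟨ occ-letters false pre ⟨
    occ lt (letters pre)                          ≡⟨ beforeTop-++ lt (letters pre) (letters cs) (no-top (letters pre) (letters cs) split) ⟨
    beforeTop lt (letters pre ++ top ∷ letters cs) ≡⟨ cong (beforeTop lt) split ⟨
    beforeTop lt (letters p)                      ∎
    where
    open ≤-Reasoning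
    pre = as ++ (false ∷ []) ∷ bs
    split : letters p ≡ letters pre ++ top ∷ letters cs
    split = trans (cong letters (trans p≡ (trans eq (sym (++-assoc as ((false ∷ []) ∷ bs) ([] ∷ cs)))))) (map-++ last pre ([] ∷ cs))
    left : branch false as ++ [] ∷ branch false (bs ++ [] ∷ cs) ≡ triplePattern
    left = trans (sym (mapMaybe-++ (strip false) as _)) (trans (cong (branch false) (sym (trans p≡ eq))) (sub false))
  sided false refl with mapMaybe-order (inWindow 3 u) c j-in i-in j⟨s⟩i
  ... | as , bs , cs , eq = begin
    beforeTop rt (letters p)                      ≡⟨ cong (beforeTop rt) split ⟩
    beforeTop rt (letters as ++ top ∷ _)          ≡⟨ beforeTop-++ rt (letters as) _ (no-top (letters as) _ split) ⟩
    occ rt (letters as)                           ≡⟨ occ-letters true as ⟩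
    length (branch true as)                       ≤⟨ m≤m+n _ _ ⟩
    length (branch true as) + length (branch true bs) ≡⟨ length-++ (branch true as) ⟨
    length (branch true as ++ branch true bs)     ≡⟨ triple-middle (branch true as ++ branch true bs) right ⟩
    1                                             ∎
    where
    open ≤-Reasoning
    split : letters p ≡ letters as ++ top ∷ letters (bs ++ (true ∷ []) ∷ cs)
    split = trans (cong letters (trans p≡ eq)) (map-++ last as ([] ∷ bs ++ (true ∷ []) ∷ cs))
    right : (branch true as ++ branch true bs) ++ [] ∷ branch true cs ≡ triplePattern
    right = trans (++-assoc (branch true as) (branch true bs) _) (trans (cong (branch true as ++_) (sym (mapMaybe-++ (strip true) bs ((true ∷ []) ∷ cs))))
      (trans (sym (mapMaybe-++ (strip true) as ([] ∷ bs ++ (true ∷ []) ∷ cs))) (trans (cong (branch true) (sym (trans p≡ eq))) (sub true))))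

-- There are 5! / (2! 2! 1!) = 30 words. The condition excludes the third of them in which `top`
-- precedes both inner `lt` (for a right child) or follows both inner `rt` (for a left child).
sidePatterns-3 : ∀ s → AtMost (SidePattern s 3) 20
sidePatterns-3 s = AtMost-≤ (≤-reflexive (size s))
  (AtMost-encode (AtMost-filter (sideCond? s) (patternWords (2 ^ 2 ∸ 2))) (AtMost-≡ triplePattern) (AtMost-≡ triplePattern) order-3)
  where
  size : ∀ s → length (filter (sideCond? s) (patternWords (2 ^ 2 ∸ 2))) * (1 * 1) ≡ 20
  size true  = refl
  size false = refl

-- In a stable configuration with 15 chips the second extreme chip on side s lies on the chain towards s,
-- but not at the bottom, so its letter is not the one of the other side.
second penultimate : List Letter → Letter
second (_ ∷ x ∷ _) = x
second _           = top
penultimate []           = top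
penultimate (x ∷ [])     = top
penultimate (x ∷ _ ∷ []) = x
penultimate (_ ∷ w@(_ ∷ _ ∷ _)) = penultimate w

penultimate-++ : ∀ w {x y} → penultimate (w ++ x ∷ y ∷ []) ≡ x
penultimate-++ [] = refl
penultimate-++ (z ∷ []) = refl
penultimate-++ (z ∷ z′ ∷ []) = refl
penultimate-++ (z ∷ z′ ∷ z″ ∷ w) = penultimate-++ (z′ ∷ z″ ∷ w)

RootCond : Bool → List Letter → Set
RootCond true  w = penultimate w ≢ lt
RootCond false w = second w ≢ rt

rootCond? : ∀ s → Decidable (RootCond s)
rootCond? true  w = ¬? (penultimate w ≟L lt)
rootCond? false w = ¬? (second w ≟L rt)

RootSide : Bool → List Vertex → Set
RootSide s p = (letters p ∈ patternWords (2 ^ 2 ∸ 2) × SideCond s (letters p) × RootCond s (letters p)) ×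
  branch false p ≡ triplePattern × branch true p ≡ triplePattern

-- Of the 20 words 6 more are excluded: fixing the forbidden letter leaves 12 arrangements of the
-- other inner letters, and half of these satisfy the side condition.
rootSide-14 : ∀ s → AtMost (RootSide s) 14
rootSide-14 s = AtMost-≤ (≤-reflexive (size s))
  (AtMost-encode (AtMost-filter (λ w → sideCond? s w ×-dec rootCond? s w) (patternWords (2 ^ 2 ∸ 2))) (AtMost-≡ triplePattern) (AtMost-≡ triplePattern) id)
  where
  size : ∀ s → length (filter (λ w → sideCond? s w ×-dec rootCond? s w) (patternWords (2 ^ 2 ∸ 2))) * (1 * 1) ≡ 14
  size true  = refl
  size false = refl

-- The recursion for T

words-bound : ∀ n k d x {b} → n + n + 1 ≡ d → k * (n ! * n ! * 1) ≡ d ! → k * x ≤ b → length (words n n 1) * x ≤ b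
words-bound n k d x {b} total k≡ = subst (λ l → l * x ≤ b) (sym words≡)
  where
  words≡ : length (words n n 1) ≡ k
  words≡ = *-cancelʳ-≡ _ _ (n ! * n ! * 1) {{m*n≢0 (n ! * n !) 1 {{m*n≢0 (n !) (n !) {{n !≢0}} {{n !≢0}}}}}} (trans (length-words d n n 1 total) (sym k≡))

T≤-sides : ∀ ℓ {a b B} → AtMost (SidePattern false (suc ℓ)) a → AtMost (SidePattern true (suc ℓ)) b →
           length (words (2 ^ suc ℓ ∸ 2) (2 ^ suc ℓ ∸ 2) 1) * (a * b) ≤ B → T≤ (2 + ℓ) B
T≤-sides ℓ {a} {b} {B} L R le = AtMost-≤ (subst (λ k → k * (a * b) ≤ B) (sym (length-map (λ w → lt ∷ (w ∷ʳ rt)) (words n n 1))) le)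
  (AtMost-encode (AtMost-∈ (patternWords n)) L R λ op → letters-order {ℓ} op , branch-side false op , branch-side true op)
  where n = 2 ^ suc ℓ ∸ 2

T≤-4 : T≤ 4 (TBound 4)
T≤-4 = T≤-sides 2 (sidePatterns-3 false) (sidePatterns-3 true)
  -- 12012 = 13! / (6! 6! 1!), certified by a factorial identity so that the words need not be
  -- listed. As `TBound 4` = 9009000 = 12012 * 750, a product of side counts up to 750 would fit.
  (words-bound (2 ^ 3 ∸ 2) 12012 13 (20 * 20) refl refl (≤ᵇ⇒≤ (12012 * 400) (TBound 4) _))

T≤-suc : ∀ j → T≤ (4 + j) (TBound (4 + j)) → T≤ (5 + j) (TBound (5 + j))
T≤-suc j T≤B = T≤-sides (3 + j) (sided false) (sided true) bound
  where
  open ≤-Reasoning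
  sided : ∀ s → AtMost (SidePattern s (4 + j)) (TBound (4 + j))
  sided s = AtMost-injective id side⇒order (λ _ _ eq → eq) T≤B
  n = 2 ^ (4 + j) ∸ 2
  q = 2 ^ (2 + j) ∸ 2
  2^≡ : 2 ^ (2 + j) ≡ 2 + q
  2^≡ = sym (m+[n∸m]≡n (^-monoʳ-≤ 2 {1} {2 + j} (s≤s z≤n)))
  n≡ : n ≡ 6 + 4 * q
  n≡ = cong (_∸ 2) (2^[4+j] j q 2^≡)
  total : ∀ q → 6 + 4 * q + (6 + 4 * q) + 1 ≡ 13 + 8 * q
  total = solve-∀
  μ = length (words n n 1)
  μ-* : μ * ((6 + 4 * q) ! * (6 + 4 * q) !) ≡ (13 + 8 * q) !
  μ-* = trans (cong₂ _*_ (cong (λ k → length (words k k 1)) n≡) (sym (*-identityʳ _)))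
    (length-words (13 + 8 * q) (6 + 4 * q) (6 + 4 * q) 1 (total q))
  F = commonFactor (4 + j)
  shuffle : ∀ μ F b → μ * (F * b * (F * b)) ≡ F * F * b * (μ * b)
  shuffle = solve-∀
  bound : μ * (TBound (4 + j) * TBound (4 + j)) ≤ TBound (5 + j)
  bound = begin
    μ * (F * β (4 + j) * (F * β (4 + j)))    ≡⟨ shuffle μ F (β (4 + j)) ⟩
    F * F * β (4 + j) * (μ * β (4 + j))      ≤⟨ *-monoʳ-≤ (F * F * β (4 + j)) (β-growth j q 2^≡ μ μ-*) ⟩
    F * F * β (4 + j) * β (5 + j)            ≡⟨ cong (_* β (5 + j)) (commonFactor-suc j) ⟨
    TBound (5 + j)                           ∎

T≤-TBound : ∀ j → T≤ (4 + j) (TBound (4 + j))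
T≤-TBound zero    = T≤-4
T≤-TBound (suc j) = T≤-suc j (T≤-TBound j)

-- Whole configurations and the bound on Z

last-two : ∀ {A : Set} {n} (c : Vec A (2 + n)) → ∃ λ xs → ∃₂ λ i j → n ≤ toℕ i × n ≤ toℕ j × toList c ≡ xs ++ lookup c i ∷ lookup c j ∷ []
last-two {n = zero} (x ∷ y ∷ []) = [] , zero , suc zero , z≤n , z≤n , refl
last-two {n = suc n} (x ∷ c) with last-two c
... | xs , i , j , n≤i , n≤j , eq = x ∷ xs , suc i , suc j , s≤s n≤i , s≤s n≤j , cong (x ∷_) eq

record Corners {A : Set} {N} (c : Vec A N) : Set where
  field
    i₁ i₂ j₁ j₂ : Fin N
    inner       : List A
    i₁≤         : toℕ i₁ ≤ 1
    i₂≤         : toℕ i₂ ≤ 1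
    ≤j₁         : N ≤ 2 + toℕ j₁
    ≤j₂         : N ≤ 2 + toℕ j₂
    shape       : toList c ≡ lookup c i₁ ∷ lookup c i₂ ∷ (inner ++ lookup c j₁ ∷ lookup c j₂ ∷ [])

corners : ∀ {A : Set} {N} (c : Vec A N) → 4 ≤ N → Corners c
corners (x ∷ y ∷ c@(_ ∷ _ ∷ _)) _ with last-two c
... | xs , i , j , n≤i , n≤j , eq = record
  { i₁ = zero ; i₂ = suc zero ; j₁ = suc (suc i) ; j₂ = suc (suc j) ; inner = xs
  ; i₁≤ = z≤n ; i₂≤ = s≤s z≤n ; ≤j₁ = s≤s (s≤s (s≤s (s≤s n≤i))) ; ≤j₂ = s≤s (s≤s (s≤s (s≤s n≤j)))
  ; shape = cong (λ zs → x ∷ y ∷ zs) eq }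
corners (x ∷ y ∷ z ∷ []) (s≤s (s≤s (s≤s ())))
corners (x ∷ y ∷ []) (s≤s (s≤s ()))
corners (x ∷ []) (s≤s ())

extreme-false : ∀ {N} {i : Fin N} → toℕ i ≤ 1 → Extreme false i
extreme-false i≤1 j<k k<i = contradiction (≤-trans (s≤s (≤-trans (s≤s z≤n) j<k)) (≤-trans k<i i≤1)) λ { (s≤s ()) }

extreme-true : ∀ {N} {i : Fin N} → N ≤ 2 + toℕ i → Extreme true i
extreme-true {i = i} N≤ {j} k<j i<k = <⇒≱ (toℕ<n j) (≤-trans N≤ (≤-trans (s≤s i<k) k<j))

last-chain : ∀ {s} w → All (_≡ s) w → last w ≢ just (not s)
last-chain {true}  (true ∷ []) _ ()
last-chain {false} (false ∷ []) _ ()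
last-chain (_ ∷ _ ∷ w) (_ ∷ a ∷ as) = last-chain (_ ∷ w) (a ∷ as)
last-chain {true}  (false ∷ []) (() ∷ _)
last-chain {false} (true ∷ []) (() ∷ _)

module Whole (ℓ : ℕ) (2≤ℓ : 2 ≤ ℓ) {c : Config (2 ^ suc ℓ ∸ 1)} (reached : Reachable c) (stable : IsStable c) where
  open Window (suc ℓ) reached stable

  pattern-whole : pattern′ (suc ℓ) [] c ≡ toList c
  pattern-whole = go c short
    where
    go : ∀ {N} (c : Config N) → (∀ i → length (lookup c i) < suc ℓ) → mapMaybe (inWindow (suc ℓ) []) (toList c) ≡ toList c
    go [] _ = refl
    go (u ∷ c) short with inWindow (suc ℓ) [] u | trans (cong (inWindow (suc ℓ) []) (sym (++-identityʳ u))) (inWindow-++ {suc ℓ} [] u (short zero))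
    ... | _ | refl = cong (u ∷_) (go c (short ∘ suc))

  branch-whole : ∀ b → SidePattern b ℓ (branch b (toList c))
  branch-whole b = suc ℓ , ≤-refl , c , (reached , stable) , [] ,
    sym (trans (+-∸-assoc 1 {ℓ} {ℓ} ≤-refl) (cong suc (n∸n≡0 ℓ))) , trans (cong (branch b) (sym pattern-whole)) (branch-pattern ℓ b [] c)

  private
    4≤N : 4 ≤ 2 ^ suc ℓ ∸ 1
    4≤N = ≤-trans (s≤s (s≤s (s≤s (s≤s z≤n)))) (∸-monoˡ-≤ 1 (^-monoʳ-≤ 2 (s≤s 2≤ℓ)))
    open Corners (corners c 4≤N)

    -- The whole path to an extreme chip consists of `s` and is not empty, so the part below the
    -- child of the root also ends in `s` or is empty.
    inner-branch : ∀ s i → Extreme s i → ∃ λ t → lookup c i ≡ t ∷ʳ s × last t ≢ just (not s)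
    inner-branch s i ext with extreme-below (s≤s 2≤ℓ) s i ext
    ... | t , at = t , at , last-chain t (All.++⁻ˡ t (subst (All (_≡ s)) at (on-chain s i ext)))

    ext₁ = inner-branch false i₁ (extreme-false i₁≤)
    ext₂ = inner-branch false i₂ (extreme-false i₂≤)
    ext₃ = inner-branch true j₁ (extreme-true ≤j₁)
    ext₄ = inner-branch true j₂ (extreme-true ≤j₂)

    u₁ = proj₁ ext₁
    u₂ = proj₁ ext₂
    w₁ = proj₁ ext₃
    w₂ = proj₁ ext₄

    shape′ : toList c ≡ (u₁ ∷ʳ false) ∷ (u₂ ∷ʳ false) ∷ (inner ++ (w₁ ∷ʳ true) ∷ (w₂ ∷ʳ true) ∷ [])
    shape′ = trans shape (cong₂ _∷_ (proj₁ (proj₂ ext₁)) (cong₂ _∷_ (proj₁ (proj₂ ext₂))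
      (cong (inner ++_) (cong₂ (λ x y → x ∷ y ∷ []) (proj₁ (proj₂ ext₃)) (proj₁ (proj₂ ext₄))))))

    L = letters inner

    letters≡ : letters (toList c) ≡ lt ∷ lt ∷ (L ++ rt ∷ rt ∷ [])
    letters≡ = trans (cong letters shape′) (cong₂ _∷_ (last-∷ʳ u₁ false) (cong₂ _∷_ (last-∷ʳ u₂ false)
      (trans (map-++ last inner _) (cong (L ++_) (cong₂ (λ x y → x ∷ y ∷ []) (last-∷ʳ w₁ true) (last-∷ʳ w₂ true))))))

    occ≡ : ∀ x {k} → occ x (letters (pattern′ (suc ℓ) [] c)) ≡ k → occ x (lt ∷ lt ∷ (L ++ rt ∷ rt ∷ [])) ≡ k
    occ≡ x eq = trans (cong (occ x) (trans (sym letters≡) (cong letters (sym pattern-whole)))) eq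

    full≡ : full ℓ ≡ 2 + (2 ^ ℓ ∸ 3)
    full≡ = +-∸-assoc 2 {2 ^ ℓ} {3} (≤-trans (n≤1+n 3) (^-monoʳ-≤ 2 2≤ℓ))

  letters-whole : letters (toList c) ∈ configWords (2 ^ ℓ ∸ 3)
  letters-whole = subst (_∈ configWords (2 ^ ℓ ∸ 3)) (sym letters≡) (∈-configWords L
    (suc-injective (suc-injective (trans (cong (2 +_) (sym (trans (occ-++ lt L (rt ∷ rt ∷ [])) (+-identityʳ _)))) (trans (occ≡ lt (occ-pattern ℓ false [] refl)) full≡))))
    (suc-injective (suc-injective (trans (sym (trans (occ-++ rt L (rt ∷ rt ∷ [])) (+-comm (occ rt L) 2))) (trans (occ≡ rt (occ-pattern ℓ true [] refl)) full≡))))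
    (trans (sym (trans (occ-++ top L (rt ∷ rt ∷ [])) (+-identityʳ _))) (occ≡ top (occ-top ℓ [] refl))))

  second-left : second (letters (branch false (toList c))) ≢ rt
  second-left eq = proj₂ (proj₂ ext₂) (trans (sym (cong (second ∘ letters) left)) eq)
    where
    rest = inner ++ (w₁ ∷ʳ true) ∷ (w₂ ∷ʳ true) ∷ []
    left : branch false (toList c) ≡ u₁ ∷ u₂ ∷ branch false rest
    left = trans (cong (branch false) shape′) (trans (branch-∷ʳ false u₁ ((u₂ ∷ʳ false) ∷ rest)) (cong (u₁ ∷_) (branch-∷ʳ false u₂ rest)))

  penultimate-right : penultimate (letters (branch true (toList c))) ≢ lt
  penultimate-right eq = proj₂ (proj₂ ext₃) (trans (sym (trans (cong penultimate right) (penultimate-++ (letters (branch true pre))))) eq)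
    where
    pre = (u₁ ∷ʳ false) ∷ (u₂ ∷ʳ false) ∷ inner
    right : letters (branch true (toList c)) ≡ letters (branch true pre) ++ last w₁ ∷ last w₂ ∷ []
    right = trans (cong (letters ∘ branch true) shape′) (trans (cong letters (mapMaybe-++ (strip true) pre _))
      (trans (map-++ last (branch true pre) _) (cong (λ zs → letters (branch true pre) ++ letters zs) (trans (branch-∷ʳ true w₁ ((w₂ ∷ʳ true) ∷ [])) (cong (w₁ ∷_) (branch-∷ʳ true w₂ []))))))

IsConfig : ℕ → List Vertex → Set
IsConfig ℓ p = Σ (Config (2 ^ ℓ ∸ 1)) λ c → StableConfig c × p ≡ toList c

Z≤-lists : ∀ {ℓ b} → AtMost (IsConfig ℓ) b → Z≤ ℓ b
Z≤-lists = AtMost-injective toList (λ {c} st → c , st , refl) (λ {c} {d} _ _ eq → trans (sym (cast-is-id refl c)) (toList-injective refl c d eq))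

-- The properties of the two branches are left open: `RootSide` for four layers, order patterns for
-- more.
Z≤-sides : ∀ ℓ (2≤ℓ : 2 ≤ ℓ) {PL PR : List Vertex → Set} {a b B} → AtMost PL a → AtMost PR b →
           (∀ {c} → StableConfig {2 ^ suc ℓ ∸ 1} c → PL (branch false (toList c)) × PR (branch true (toList c))) →
           length (words (2 ^ ℓ ∸ 3) (2 ^ ℓ ∸ 3) 1) * (a * b) ≤ B → Z≤ (suc ℓ) B
Z≤-sides ℓ 2≤ℓ {a = a} {b} {B} L R sides le = Z≤-lists {suc ℓ}
  (AtMost-≤ (subst (λ k → k * (a * b) ≤ B) (sym (length-map (λ w → lt ∷ lt ∷ (w ++ rt ∷ rt ∷ [])) (words n n 1))) le)
    (AtMost-encode (AtMost-∈ (configWords n)) L R λ { (c , st@(reached , stable) , refl) → Whole.letters-whole ℓ 2≤ℓ reached stable , sides {c} st }))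
  where n = 2 ^ ℓ ∸ 3

Z≤-4 : Z≤ 4 (ZBound 4)
Z≤-4 = Z≤-sides 3 (s≤s (s≤s z≤n)) (rootSide-14 false) (rootSide-14 true) rootSides
  -- 2772 = 11! / (5! 5! 1!) and `ZBound 4` = 693000 = 2772 * 250, so already counts of 20 and 14
  -- would be too large: the second extreme chips matter on both sides.
  (words-bound (2 ^ 3 ∸ 3) 2772 11 (14 * 14) refl refl (≤ᵇ⇒≤ (2772 * 196) (ZBound 4) _))
  where
  rootSides : ∀ {c} → StableConfig {2 ^ 4 ∸ 1} c → RootSide false (branch false (toList c)) × RootSide true (branch true (toList c))
  rootSides {c} (reached , stable) = left , right
    where
    open Whole 3 (s≤s (s≤s z≤n)) reached stable
    left : RootSide false (branch false (toList c))
    left = let (w∈ , cond) , subs = order-3 (branch-whole false) in (w∈ , cond , second-left) , subs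
    right : RootSide true (branch true (toList c))
    right = let (w∈ , cond) , subs = order-3 (branch-whole true) in (w∈ , cond , penultimate-right) , subs

Z≤-suc : ∀ j → T≤ (4 + j) (TBound (4 + j)) → Z≤ (5 + j) (ZBound (5 + j))
Z≤-suc j T≤B = Z≤-sides (4 + j) 2≤ T≤B T≤B
  (λ (reached , stable) → let branches = Whole.branch-whole (4 + j) 2≤ reached stable in
     side⇒order (branches false) , side⇒order (branches true)) bound
  where
  open ≤-Reasoning
  2≤ : 2 ≤ 4 + j
  2≤ = s≤s (s≤s z≤n)
  n = 2 ^ (4 + j) ∸ 3
  q = 2 ^ (2 + j) ∸ 2
  2^≡ : 2 ^ (2 + j) ≡ 2 + q
  2^≡ = sym (m+[n∸m]≡n (^-monoʳ-≤ 2 {1} {2 + j} (s≤s z≤n)))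
  n≡ : n ≡ 5 + 4 * q
  n≡ = cong (_∸ 3) (2^[4+j] j q 2^≡)
  total : ∀ q → 5 + 4 * q + (5 + 4 * q) + 1 ≡ 11 + 8 * q
  total = solve-∀
  ν = length (words n n 1)
  ν-* : ν * ((5 + 4 * q) ! * (5 + 4 * q) !) ≡ (11 + 8 * q) !
  ν-* = trans (cong₂ _*_ (cong (λ k → length (words k k 1)) n≡) (sym (*-identityʳ _)))
    (length-words (11 + 8 * q) (5 + 4 * q) (5 + 4 * q) 1 (total q))
  F = commonFactor (4 + j)
  shuffle : ∀ ν F b → ν * (F * b * (F * b)) ≡ F * F * b * (ν * b)
  shuffle = solve-∀
  bound : ν * (TBound (4 + j) * TBound (4 + j)) ≤ ZBound (5 + j)
  bound = begin
    ν * (F * β (4 + j) * (F * β (4 + j)))    ≡⟨ shuffle ν F (β (4 + j)) ⟩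
    F * F * β (4 + j) * (ν * β (4 + j))      ≤⟨ *-monoʳ-≤ (F * F * β (4 + j)) (γ-growth j q 2^≡ ν ν-*) ⟩
    F * F * β (4 + j) * γ (5 + j)            ≡⟨ cong (_* γ (5 + j)) (commonFactor-suc j) ⟨
    ZBound (5 + j)                           ∎

Z≤-ZBound : ∀ j → Z≤ (4 + j) (ZBound (4 + j))
Z≤-ZBound zero    = Z≤-4
Z≤-ZBound (suc j) = Z≤-suc j (T≤-TBound j)

mainTheorem7 : (ℓ : ℕ) → 4 ≤ ℓ → T≤ ℓ (TBound ℓ) × Z≤ ℓ (ZBound ℓ)
mainTheorem7 ℓ (s≤s (s≤s (s≤s (s≤s (z≤n {j}))))) = T≤-TBound j , Z≤-ZBound j
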